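{- Let $G$ be a $3$-connected graph. If $\max\{d_G(x), d_G(y)\}\geq \widetilde{\alpha}(G)+1$ for any nonadjacent vertices $x$ and $y$ with $d_G(x,y)=2$, then $G$ is hamiltonian-connected.
   Context: All graphs are finite and simple. $d_G(v)$ denotes the degree of a vertex $v$ in $G$, and $d_G(x,y)$ denotes the distance between $x$ and $y$ in $G$. The bipartite independence number $\widetilde{\alpha}(G)$ of a graph $G$ is the smallest integer $q$ for which there exist positive integers $s$ and $t$ with $s+t=q+1$ such that for any two disjoint subsets $A,B\subseteq V(G)$ with $|A|=s$ and $|B|=t$, there is an edge of $G$ with one endpoint in $A$ and the other in $B$. A graph is hamiltonian-connected if for any two distinct vertices $x,y$ there is a path from $x$ to $y$ containing every vertex of the graph. -}

module Defs where

open import Data.Nat using (ℕ; zero; suc; _+_; _∸_; _≤_; _<_; _≥_; _⊔_)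
open import Data.Fin using (Fin)
open import Data.Fin.Subset using (Subset; _∈_; _∉_; ∣_∣)
open import Data.Bool using (Bool; true; false)
open import Data.Vec using (tabulate)
open import Data.List using (List; []; _∷_; length)
open import Data.List.Relation.Unary.All using (All)
open import Data.List.Relation.Unary.Unique.Propositional using (Unique)
import Data.List.Membership.Propositional as LM
open import Data.Product using (Σ; ∃; ∃-syntax; _×_; _,_)
open import Relation.Binary.PropositionalEquality using (_≡_; _≢_)
open import Relation.Nullary using (¬_)

record Graph : Set where
  field
    n     : ℕ
    adj   : Fin n → Fin n → Bool
    sym   : ∀ x y → adj x y ≡ adj y x
    irrefl : ∀ x → adj x x ≡ false

open Graph public

V : Graph → Set
V G = Fin (n G)

Adj : (G : Graph) → V G → V G → Set
Adj G x y = adj G x y ≡ true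

N : (G : Graph) → V G → Subset (n G)
N G v = tabulate (adj G v)

deg : (G : Graph) → V G → ℕ
deg G v = ∣ N G v ∣

data Walk (G : Graph) : V G → V G → List (V G) → Set where
  single : ∀ x → Walk G x x (x ∷ [])
  step   : ∀ {x z y vs} → Adj G x z → Walk G z y vs → Walk G x y (x ∷ vs)

walkLength : ∀ {A : Set} → List A → ℕ
walkLength vs = length vs ∸ 1

Dist : (G : Graph) → V G → V G → ℕ → Set
Dist G x y k =
  (∃[ vs ] (Walk G x y vs × walkLength vs ≡ k)) ×
  (∀ vs → Walk G x y vs → k ≤ walkLength vs)

ConnectedMinus : (G : Graph) → Subset (n G) → Set
ConnectedMinus G X =
  ∀ u v → u ∉ X → v ∉ X →
    ∃[ vs ] (Walk G u v vs × All (λ w → w ∉ X) vs)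

KConnected : ℕ → Graph → Set
KConnected k G = k < n G × (∀ (X : Subset (n G)) → ∣ X ∣ < k → ConnectedMinus G X)

BipProp : (G : Graph) → ℕ → ℕ → Set
BipProp G s t =
  ∀ (A B : Subset (n G)) → ∣ A ∣ ≡ s → ∣ B ∣ ≡ t →
    (∀ v → v ∈ A → v ∉ B) →
    ∃[ a ] ∃[ b ] (a ∈ A × b ∈ B × Adj G a b)

BipGood : Graph → ℕ → Set
BipGood G q = ∃[ s ] ∃[ t ] (1 ≤ s × 1 ≤ t × s + t ≡ suc q × BipProp G s t)

IsBipIndepNum : Graph → ℕ → Set
IsBipIndepNum G q = BipGood G q × (∀ q′ → q′ < q → ¬ BipGood G q′)

HamPath : (G : Graph) → V G → V G → Set
HamPath G x y =
  ∃[ vs ] (Walk G x y vs × Unique vs × (∀ v → v LM.∈ vs))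

HamiltonianConnected : Graph → Set
HamiltonianConnected G = ∀ x y → x ≢ y → HamPath G x y

{-# OPTIONS --safe #-}
-- Call a vertex heavy if its degree exceeds α, light otherwise, and let G′ be G with all edges between heavy
-- vertices added.
--
-- A Hamiltonian x-y path of G′ yields one of G.  Deleting an added edge uv and joining x and y through a new
-- vertex leaves a Hamiltonian path from u to v.  If it is v₁ … vₙ, then u adjacent to vₐ₊₁ and v adjacent to a
-- vertex further along (before), together with an edge from vₐ to the successor (predecessor) of that vertex, close
-- a cycle that uses no other new edges.  As u and v have at least α + 1 = s + t neighbours, cutting the path at
-- the s-th usable neighbour of u leaves s and t such candidates in one of the two arrangements, and the bipartite
-- hole condition supplies the edge.
--
-- The graph G′ has a Hamiltonian x-y path.  Two light vertices with a common neighbour are adjacent, so the light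
-- vertices form disjoint cliques with disjoint heavy neighbourhoods.  By 3-connectivity each clique has two
-- disjoint edges to heavy vertices other than y; since the heavy vertices form a clique of G′, a rotation inserts
-- it into a path through all heavy vertices.  The cliques of x and y are put in place first.
module Submission where

open import Defs hiding (sym; n)
open import Data.Bool using (true; false; if_then_else_)
import Data.Bool.Properties as Bool
open import Data.Empty using (⊥-elim)
open import Data.Fin using (Fin; zero; suc)
open import Data.Fin.Properties using (_≟_; any?)
open import Data.Fin.Subset as Subset using (Subset; inside; outside; ∣_∣)
import Data.Fin.Subset.Properties as Subset
open import Data.List using (List; []; _∷_; _++_; length; reverse; mapMaybe; map; take; filter; allFin)
open import Data.List.Properties
  using (∷-injectiveˡ; ∷-injectiveʳ; ++-assoc; unfold-reverse; length-++; map-++; length-take)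
open import Data.List.Membership.Propositional using (_∈_; _∉_)
open import Data.List.Membership.Propositional.Properties
  using (∈-∃++; ∈-++⁺ˡ; ∈-++⁺ʳ; ∈-++⁻; ∈-map⁺; ∈-map⁻; ∈-filter⁺; ∈-filter⁻; ∈-allFin)
open import Data.List.Relation.Binary.Permutation.Propositional using (_↭_; ↭-sym; ↭-trans; ↭⇒↭ₛ)
open import Data.List.Relation.Binary.Permutation.Propositional.Properties as Perm using (↭-reverse; ∈-resp-↭)
import Data.List.Relation.Binary.Permutation.Setoid.Properties as PermS
open import Data.List.Relation.Binary.Sublist.Propositional using (_⊆_; []; _∷_; _∷ʳ_; ⊆-refl; ⊆-trans; lookup)
open import Data.List.Relation.Binary.Sublist.Propositional.Properties using (All-resp-⊆; take-⊆; ++⁺; ++⁺ˡ; ++⁺ʳ)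
open import Data.List.Relation.Unary.All as All using (All; []; _∷_)
open import Data.List.Relation.Unary.AllPairs using ([]; _∷_)
open import Data.List.Relation.Unary.Any using (here; there)
open import Data.List.Relation.Unary.Unique.Propositional using (Unique)
import Data.List.Relation.Unary.Unique.Propositional.Properties as Unique
open import Data.Maybe using (Maybe; just; nothing)
open import Data.Maybe.Properties using (just-injective)
open import Data.Nat using (ℕ; zero; suc; _+_; _<_; _≤_; _≥_; _⊔_; z≤n; s≤s; s≤s⁻¹)
open import Data.Nat.Properties
  using (+-assoc; +-comm; +-identityʳ; +-suc; +-mono-≤; +-monoˡ-≤; +-monoʳ-≤; +-cancelˡ-≤; m≤n+m; n≤1+n; m≤n⇒m⊓n≡m;
         ≤-refl; ≤-trans; ≤-reflexive; <⇒≱; ≰⇒>; _≤?_; ⊔-lub; suc-injective; module ≤-Reasoning)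
open import Data.Nat.Solver using (module +-*-Solver)
open import Data.Product using (∃-syntax; _×_; _,_; proj₁; proj₂)
open import Data.Sum using (_⊎_; inj₁; inj₂; [_,_]′)
open import Data.Unit using (⊤; tt)
open import Data.Vec using (_∷_; here; there; _[_]≔_)
import Data.Vec.Properties as Vec
open import Function using (_∘_)
open import Relation.Binary.PropositionalEquality
open import Relation.Nullary using (¬_; yes; no; contradiction; Dec)
open import Relation.Nullary.Decidable using (_×-dec_; _⊎-dec_; ¬?; decidable-stable)
open import Relation.Unary using (Decidable)
open +-*-Solver using (solve; con; _:+_; _:=_)

private variable
  A B         : Set
  i j k m n   : ℕ
  xs ys       : List A

-- Repetition-free lists, partial maps and positions in lists.

Unique-⊆ : xs ⊆ ys → Unique ys → Unique xs
Unique-⊆ []         []      = []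
Unique-⊆ (_ ∷ʳ s)   (_ ∷ u) = Unique-⊆ s u
Unique-⊆ (refl ∷ s) (a ∷ u) = All-resp-⊆ s a ∷ Unique-⊆ s u

Unique-↭ : xs ↭ ys → Unique xs → Unique ys
Unique-↭ p = PermS.Unique-resp-↭ (setoid _) (↭⇒↭ₛ p)

Unique-++⁻ˡ : ∀ {xs ys : List A} → Unique (xs ++ ys) → Unique xs
Unique-++⁻ˡ {ys = ys} = Unique-⊆ (++⁺ʳ ys ⊆-refl)

Unique-++⁻ʳ : ∀ (xs : List A) {ys} → Unique (xs ++ ys) → Unique ys
Unique-++⁻ʳ xs = Unique-⊆ (++⁺ˡ xs ⊆-refl)

Unique-++-disjoint : ∀ {x : A} xs {ys} → Unique (xs ++ ys) → x ∈ xs → x ∉ ys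
Unique-++-disjoint (_ ∷ xs) (a ∷ u) (here refl) q = All.lookup a (∈-++⁺ʳ xs q) refl
Unique-++-disjoint (_ ∷ xs) (_ ∷ u) (there p)   q = Unique-++-disjoint xs u p q

mapMaybe-++ : ∀ (f : A → Maybe B) xs {ys} → mapMaybe f (xs ++ ys) ≡ mapMaybe f xs ++ mapMaybe f ys
mapMaybe-++ f []       = refl
mapMaybe-++ f (x ∷ xs) with f x
... | just _  = cong (_ ∷_) (mapMaybe-++ f xs)
... | nothing = mapMaybe-++ f xs

∈-mapMaybe⁻ : ∀ (f : A → Maybe B) xs {y} → y ∈ mapMaybe f xs → ∃[ x ] (x ∈ xs × f x ≡ just y)
∈-mapMaybe⁻ f (x ∷ xs) p with f x in eq
∈-mapMaybe⁻ f (x ∷ xs) (here refl) | just _  = x , here refl , eq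
∈-mapMaybe⁻ f (x ∷ xs) (there p)   | just _  with ∈-mapMaybe⁻ f xs p
... | w , q , e = w , there q , e
∈-mapMaybe⁻ f (x ∷ xs) p           | nothing with ∈-mapMaybe⁻ f xs p
... | w , q , e = w , there q , e

split-at-hit : ∀ (f : A → Maybe B) xs m → m < length (mapMaybe f xs) →
  ∃[ F ] ∃[ e ] ∃[ S ] ∃[ y ] (xs ≡ F ++ e ∷ S × f e ≡ just y × length (mapMaybe f F) ≡ m)
split-at-hit f (x ∷ xs) m lt with f x in eq
split-at-hit f (x ∷ xs) m lt | nothing with split-at-hit f xs m lt
... | F , e , S , y , refl , q , r = x ∷ F , e , S , y , refl , q , lemma
  where lemma : length (mapMaybe f (x ∷ F)) ≡ m
        lemma rewrite eq = r
split-at-hit f (x ∷ xs) zero lt | just y = [] , x , xs , y , refl , eq , refl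
split-at-hit f (x ∷ xs) (suc m) (s≤s lt) | just _ with split-at-hit f xs m lt
... | F , e , S , y , refl , q , r = x ∷ F , e , S , y , refl , q , lemma
  where lemma : length (mapMaybe f (x ∷ F)) ≡ suc m
        lemma rewrite eq = cong suc r

∈-order : ∀ {e e′ : A} {xs} → e ∈ xs → e′ ∈ xs → e ≢ e′ →
  ∃[ P ] ∃[ S ] (xs ≡ P ++ S × (e ∈ P × e′ ∈ S ⊎ e′ ∈ P × e ∈ S))
∈-order (here refl) (here refl) ne = ⊥-elim (ne refl)
∈-order {xs = x ∷ xs} (here refl) (there q) ne = x ∷ [] , xs , refl , inj₁ (here refl , q)
∈-order {xs = x ∷ xs} (there p) (here refl) ne = x ∷ [] , xs , refl , inj₂ (here refl , p)
∈-order {xs = x ∷ xs} (there p) (there q) ne with ∈-order p q ne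
... | P , S , refl , inj₁ (a , b) = x ∷ P , S , refl , inj₁ (there a , b)
... | P , S , refl , inj₂ (a , b) = x ∷ P , S , refl , inj₂ (there a , b)

-- Weighted trails and ways of cutting them.

pairs : List A → List (A × A)
pairs (x ∷ y ∷ l) = (x , y) ∷ pairs (y ∷ l)
pairs _           = []

module _ {A : Set} (E : ℕ → A → A → Set) where

  -- The index of `E` is a weight that adds up along the trail. For `Link` it counts the added
  -- edges, the quantity to be brought down to 0.
  data Trail : ℕ → A → A → List A → Set where
    [_] : ∀ x → Trail 0 x x (x ∷ [])
    _∷_ : ∀ {i j x y z l} → E i x y → Trail j y z l → Trail (i + j) x z (x ∷ l)

  record Cut (k : ℕ) (x y : A) (l : List A) (F : List (A × A)) (p q : A) (S : List (A × A)) : Set where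
    constructor cut
    field
      {i₁ j₁ i₂} : ℕ
      {l₁ l₂}    : List A
      left       : Trail i₁ x p l₁
      link       : E j₁ p q
      right      : Trail i₂ q y l₂
      list≡      : l ≡ l₁ ++ l₂
      weight≡    : k ≡ i₁ + (j₁ + i₂)
      before≡    : pairs l₁ ≡ F
      after≡     : pairs l₂ ≡ S

  -- Removing two links leaves three segments; the exchange arguments below reverse some of them and
  -- join them anew.
  record Cut₂ (k : ℕ) (x y : A) (l : List A) (p p′ q q′ : A) : Set where
    constructor cut₂
    field
      {i₁ j₁ i₂ j₂ i₃} : ℕ
      {l₁ l₂ l₃}       : List A
      left             : Trail i₁ x p l₁
      link₁            : E j₁ p p′
      middle           : Trail i₂ p′ q l₂
      link₂            : E j₂ q q′
      right            : Trail i₃ q′ y l₃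
      list≡            : l ≡ l₁ ++ (l₂ ++ l₃)
      weight≡          : k ≡ i₁ + (j₁ + (i₂ + (j₂ + i₃)))

module _ {A : Set} {E : ℕ → A → A → Set} where

  private variable
    p p′ q q′ : A
    l l′      : List A

  recast : ∀ {x y : A} → i ≡ j → l ≡ l′ → Trail E i x y l → Trail E j x y l′
  recast refl refl t = t

  head≡ : ∀ {x y : A} → Trail E k x y l → ∃[ l′ ] l ≡ x ∷ l′
  head≡ [ x ]   = [] , refl
  head≡ (_ ∷ _) = _ , refl

  start∈ : ∀ {x y : A} → Trail E k x y l → x ∈ l
  start∈ [ x ]   = here refl
  start∈ (_ ∷ _) = here refl

  end∈ : ∀ {x y : A} → Trail E k x y l → y ∈ l
  end∈ [ x ]   = here refl
  end∈ (_ ∷ t) = there (end∈ t)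

  join : ∀ {x y z w : A} → Trail E i x y l → E j y z → Trail E k z w l′ → Trail E (i + (j + k)) x w (l ++ l′)
  join [ x ] e t = e ∷ t
  join {j = j} {k = k} (_∷_ {i = i₁} {j = i₂} f s) e t =
    recast (sym (+-assoc i₁ i₂ (j + k))) refl (f ∷ join s e t)

  rev : (∀ {i x y} → E i x y → E i y x) → ∀ {x y : A} → Trail E k x y l → Trail E k y x (reverse l)
  rev E-sym [ x ] = [ x ]
  rev E-sym (_∷_ {i = i} {j = j} {x = x} {l = l} e t) =
    recast
      (trans (cong (j +_) (+-identityʳ i)) (+-comm j i)) (sym (unfold-reverse x l))
      (join (rev E-sym t) (E-sym e) [ x ])

  -- A link is addressed by its entry in `pairs l`, so that a position found by searching this list
  -- carries over to the trail.
  split : ∀ {x y : A} {F S} → Trail E k x y l → pairs l ≡ F ++ (p , q) ∷ S → Cut E k x y l F p q S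
  split {F = []}    [ x ] ()
  split {F = _ ∷ _} [ x ] ()
  -- `pairs` reduces only once the tail is visibly a cons, hence the use of `head≡`.
  split {F = F} (_∷_ {i = i} {x = x} e t) eq with head≡ t
  split {F = []} (_∷_ {i = i} {x = x} e t) eq | _ , refl with refl ← ∷-injectiveˡ eq =
    cut [ x ] e t refl refl refl (∷-injectiveʳ eq)
  split {F = f ∷ F} (_∷_ {i = i} {x = x} e t) eq | _ , refl with split t (∷-injectiveʳ eq)
  ... | cut {i₁ = i₁} {j₁ = j₁} {i₂ = i₂} tˡ e′ tʳ r refl refl s with head≡ tˡ
  ... | _ , refl = cut (e ∷ tˡ) e′ tʳ (cong (x ∷_) r) (sym (+-assoc i i₁ (j₁ + i₂)))
      (cong₂ _∷_ (trans (cong (x ,_) (sym (∷-injectiveˡ r))) (∷-injectiveˡ eq)) refl) s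

  -- The factorisation `P ++ S` records that the first pair precedes the second, so the second cut
  -- falls into the right part left by the first.
  split₂ : ∀ {x y : A} P S → Trail E k x y l → pairs l ≡ P ++ S → (p , p′) ∈ P → (q , q′) ∈ S →
           Cut₂ E k x y l p p′ q q′
  split₂ {p = p} {p′ = p′} {q = q} {q′ = q′} P S t eq pP qS with ∈-∃++ pP | ∈-∃++ qS
  ... | P₁ , P₂ , refl | S₁ , S₂ , refl
    with split t (trans eq (++-assoc P₁ ((p , p′) ∷ P₂) _))
  ... | cut tˡ e tʳ refl refl _ aft
    with split {F = P₂ ++ S₁} tʳ (trans aft (sym (++-assoc P₂ S₁ _)))
  ... | cut tᵐ e′ tᵉ refl refl _ _ = cut₂ tˡ e tᵐ e′ tᵉ refl refl

  ∈-pairs-next : ∀ {x y : A} → Trail E k x y l → p ∈ l → p ≢ y → ∃[ q ] (p , q) ∈ pairs l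
  ∈-pairs-next [ x ] (here refl) ne = ⊥-elim (ne refl)
  ∈-pairs-next (e ∷ t) m ne with head≡ t
  ∈-pairs-next (e ∷ t) (here refl) ne | _ , refl = _ , here refl
  ∈-pairs-next (e ∷ t) (there m) ne | _ , refl with ∈-pairs-next t m ne
  ... | q , n = q , there n

-- Subsets given by lists, and counting by partial maps.

insert : Fin n → Subset n → Subset n
insert x S = S [ x ]≔ inside

∈-insert : ∀ (x : Fin n) S → x Subset.∈ insert x S
∈-insert x S = Vec.[]≔-updates S x

insert-⊆ : ∀ (x : Fin n) S {v} → v Subset.∈ S → v Subset.∈ insert x S
insert-⊆ zero    (_ ∷ S) here      = here
insert-⊆ zero    (_ ∷ S) (there m) = there m
insert-⊆ (suc x) (_ ∷ S) here      = here
insert-⊆ (suc x) (_ ∷ S) (there m) = there (insert-⊆ x S m)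

∈-insert⁻ : ∀ (x : Fin n) S {v} → v Subset.∈ insert x S → v ≡ x ⊎ v Subset.∈ S
∈-insert⁻ zero    (_ ∷ S) here      = inj₁ refl
∈-insert⁻ zero    (_ ∷ S) (there m) = inj₂ (there m)
∈-insert⁻ (suc x) (_ ∷ S) here      = inj₂ here
∈-insert⁻ (suc x) (_ ∷ S) (there m) with ∈-insert⁻ x S m
... | inj₁ refl = inj₁ refl
... | inj₂ q    = inj₂ (there q)

∣insert∣≤ : ∀ (x : Fin n) S → ∣ insert x S ∣ ≤ suc ∣ S ∣
∣insert∣≤ zero    (inside  ∷ S) = n≤1+n _
∣insert∣≤ zero    (outside ∷ S) = ≤-refl
∣insert∣≤ (suc x) (inside  ∷ S) = s≤s (∣insert∣≤ x S)
∣insert∣≤ (suc x) (outside ∷ S) = ∣insert∣≤ x S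

∣insert∣≡ : ∀ (x : Fin n) S → x Subset.∉ S → ∣ insert x S ∣ ≡ suc ∣ S ∣
∣insert∣≡ zero    (inside  ∷ S) x∉S = contradiction here x∉S
∣insert∣≡ zero    (outside ∷ S) x∉S = refl
∣insert∣≡ (suc x) (inside  ∷ S) x∉S = cong suc (∣insert∣≡ x S (x∉S ∘ there))
∣insert∣≡ (suc x) (outside ∷ S) x∉S = ∣insert∣≡ x S (x∉S ∘ there)

fromList : List (Fin n) → Subset n
fromList []       = Subset.⊥
fromList (x ∷ xs) = insert x (fromList xs)

∈-fromList⁺ : ∀ {v : Fin n} {xs} → v ∈ xs → v Subset.∈ fromList xs
∈-fromList⁺ {xs = x ∷ xs} (here refl) = ∈-insert x (fromList xs)
∈-fromList⁺ {xs = x ∷ xs} (there m)   = insert-⊆ x (fromList xs) (∈-fromList⁺ m)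

∈-fromList⁻ : ∀ {v : Fin n} xs → v Subset.∈ fromList xs → v ∈ xs
∈-fromList⁻ []       m = ⊥-elim (Subset.∉⊥ m)
∈-fromList⁻ (x ∷ xs) m with ∈-insert⁻ x (fromList xs) m
... | inj₁ eq = here eq
... | inj₂ q  = there (∈-fromList⁻ xs q)

∣fromList∣≤ : ∀ (xs : List (Fin n)) → ∣ fromList xs ∣ ≤ length xs
∣fromList∣≤ {n} []   = ≤-reflexive (Subset.∣⊥∣≡0 n)
∣fromList∣≤ (x ∷ xs) = ≤-trans (∣insert∣≤ x (fromList xs)) (s≤s (∣fromList∣≤ xs))

∣fromList∣≡ : ∀ {xs : List (Fin n)} → Unique xs → ∣ fromList xs ∣ ≡ length xs
∣fromList∣≡ {n} []                  = Subset.∣⊥∣≡0 n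
∣fromList∣≡ {xs = x ∷ xs} (x∉ ∷ u) =
  trans (∣insert∣≡ x (fromList xs) (λ m → All.lookup x∉ (∈-fromList⁻ xs m) refl)) (cong suc (∣fromList∣≡ u))

count : (A → Maybe B) → List A → ℕ
count f xs = length (mapMaybe f xs)

count-++ : ∀ (f : A → Maybe B) xs {ys} → count f (xs ++ ys) ≡ count f xs + count f ys
count-++ f xs = trans (cong length (mapMaybe-++ f xs)) (length-++ (mapMaybe f xs))

-- Phrased as a partial map so that `count hole` counts the occurrences of the extra vertex
-- `nothing`.
hole : Maybe A → Maybe ⊤
hole nothing  = just tt
hole (just _) = nothing

nothing∉⇒count-hole : ∀ {l : List (Maybe A)} → All (nothing ≢_) l → count hole l ≡ 0
nothing∉⇒count-hole {l = []}          []      = refl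
nothing∉⇒count-hole {l = nothing ∷ _} (p ∷ _) = contradiction refl p
nothing∉⇒count-hole {l = just _ ∷ _}  (_ ∷ q) = nothing∉⇒count-hole q

count-hole≤1 : ∀ {l : List (Maybe A)} → Unique l → count hole l ≤ 1
count-hole≤1 {l = []}          []      = z≤n
count-hole≤1 {l = nothing ∷ _} (p ∷ _) = s≤s (≤-reflexive (nothing∉⇒count-hole p))
count-hole≤1 {l = just _ ∷ _}  (_ ∷ u) = count-hole≤1 u

-- Getting rid of the added edges of `G′`.

module Closure (G : Graph) (α : ℕ) where

  Heavy : V G → Set
  Heavy v = suc α ≤ deg G v

  adj-sym : ∀ {u v} → Adj G u v → Adj G v u
  adj-sym {u} {v} a = trans (Graph.sym G v u) a

  ∈-N⁺ : ∀ {u v} → Adj G u v → v Subset.∈ N G u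
  ∈-N⁺ {u} {v} a = Vec.lookup⇒[]= v (N G u) (trans (Vec.lookup∘tabulate (adj G u) v) a)

  ∈-N⁻ : ∀ {u v} → v Subset.∈ N G u → Adj G u v
  ∈-N⁻ {u} {v} m = trans (sym (Vec.lookup∘tabulate (adj G u) v)) (Vec.[]=⇒lookup m)

  -- Links of weight 1 are the edges of G′ that are not edges of G.
  data Link : ℕ → V G → V G → Set where
    edge    : ∀ {u v} → Adj G u v → Link 0 u v
    missing : ∀ {u v} → Heavy u → Heavy v → ¬ Adj G u v → Link 1 u v

  Link-sym : ∀ {u v} → Link k u v → Link k v u
  Link-sym (edge a)           = edge (adj-sym a)
  Link-sym (missing hu hv na) = missing hv hu (na ∘ adj-sym)

  -- Mapped over `pairs l`, these list the predecessors, respectively successors, of the neighbours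
  -- of `w` along the path. A pair containing the extra vertex gives no hit.
  predOf succOf : V G → Maybe (V G) × Maybe (V G) → Maybe (V G)
  predOf w (just p , just q) = if adj G w q then just p else nothing
  predOf w _                 = nothing
  succOf w (just p , just q) = if adj G w p then just q else nothing
  succOf w _                 = nothing

  nbr : V G → Maybe (V G) → Maybe (V G)
  nbr w (just q) = if adj G w q then just q else nothing
  nbr w nothing  = nothing

  predOf⁻ : ∀ w e {p} → predOf w e ≡ just p → ∃[ q ] (e ≡ (just p , just q) × Adj G w q)
  predOf⁻ w (just p , just q) eq with adj G w q in a | eq
  ... | true | refl = q , refl , a

  succOf⁻ : ∀ w e {q} → succOf w e ≡ just q → ∃[ p ] (e ≡ (just p , just q) × Adj G w p)
  succOf⁻ w (just p , just q) eq with adj G w p in a | eq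
  ... | true | refl = p , refl , a

  deg≤count-nbr : ∀ w {l} → (∀ v → just v ∈ l) → deg G w ≤ count (nbr w) l
  deg≤count-nbr w {l} cov =
    ≤-trans (Subset.p⊆q⇒∣p∣≤∣q∣ (λ m → ∈-fromList⁺ (hit l (cov _) (∈-N⁻ m)))) (∣fromList∣≤ (mapMaybe (nbr w) l))
    where
    hit : ∀ l {v} → just v ∈ l → Adj G w v → v ∈ mapMaybe (nbr w) l
    hit (just v ∷ l)  (here refl) a rewrite a = here refl
    hit (nothing ∷ l) (there m)   a = hit l m a
    hit (just u ∷ l)  (there m)   a with adj G w u
    ... | true  = there (hit l m a)
    ... | false = hit l m a

  -- Every neighbour in `l` has a predecessor in `a ∷ l`; it is missed only if that predecessor is
  -- the extra vertex.
  count-nbr≤pred : ∀ w a l → count (nbr w) l ≤ count (predOf w) (pairs (a ∷ l)) + count hole (a ∷ l)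
  count-nbr≤pred w a        []            = z≤n
  count-nbr≤pred w (just p) (just q ∷ l)  with adj G w q
  ... | true  = s≤s (count-nbr≤pred w (just q) l)
  ... | false = count-nbr≤pred w (just q) l
  count-nbr≤pred w (just p) (nothing ∷ l) = count-nbr≤pred w nothing l
  count-nbr≤pred w nothing  (just q ∷ l)  with adj G w q
  ... | true  = ≤-trans (s≤s (count-nbr≤pred w (just q) l)) (≤-reflexive (sym (+-suc _ _)))
  ... | false = ≤-trans (count-nbr≤pred w (just q) l) (+-monoʳ-≤ _ (n≤1+n _))
  count-nbr≤pred w nothing  (nothing ∷ l) = ≤-trans (count-nbr≤pred w nothing l) (+-monoʳ-≤ _ (n≤1+n _))

  count-nbr-∷ : ∀ {w v} l → adj G w v ≡ false → count (nbr w) (just v ∷ l) ≡ count (nbr w) l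
  count-nbr-∷ l na rewrite na = refl

  -- The last vertex has no successor, which is why it must not be a neighbour of `w`. The first
  -- vertex is nobody's successor, so only holes in `l` are charged.
  count-nbr≤succ : ∀ {E : ℕ → Maybe (V G) → Maybe (V G) → Set} w {a v l} → adj G w v ≡ false →
    Trail E k a (just v) (a ∷ l) →
    count (nbr w) (a ∷ l) ≤ count (succOf w) (pairs (a ∷ l)) + count hole l
  count-nbr≤succ w na [ _ ] = ≤-reflexive (count-nbr-∷ [] na)
  count-nbr≤succ w na (e ∷ t) with head≡ t
  count-nbr≤succ w {a = a} na (_∷_ {y = b} e t) | l , refl with a | b | count-nbr≤succ w na t
  ... | nothing | nothing | ih = ≤-trans ih (+-monoʳ-≤ _ (n≤1+n _))
  ... | nothing | just q  | ih = ih
  ... | just p  | nothing | ih with adj G w p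
  ...   | true  = ≤-trans (s≤s ih) (≤-reflexive (sym (+-suc _ _)))
  ...   | false = ≤-trans ih (+-monoʳ-≤ _ (n≤1+n _))
  count-nbr≤succ w {a = a} na (_∷_ {y = b} e t) | l , refl | just p | just q | ih with adj G w p
  ...   | true  = s≤s ih
  ...   | false = ih

  -- The last vertex is never a predecessor within the trail, so `b` can be appended: at a cut it is
  -- the predecessor belonging to the cut pair. A sublist, unlike a mere subset, inherits
  -- uniqueness.
  preds-⊆ : ∀ {E : ℕ → Maybe (V G) → Maybe (V G) → Set} w {a b l} → Trail E k a b l →
    map just (mapMaybe (predOf w) (pairs l)) ++ b ∷ [] ⊆ l
  preds-⊆ w [ _ ] = refl ∷ []
  preds-⊆ w (e ∷ t) with head≡ t
  preds-⊆ w (_∷_ {x = a} {y = b} e t) | l , refl with a | b | preds-⊆ w t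
  ... | nothing | _       | ih = nothing ∷ʳ ih
  ... | just p  | nothing | ih = just p ∷ʳ ih
  ... | just p  | just q  | ih with adj G w q
  ...   | true  = refl ∷ ih
  ...   | false = just p ∷ʳ ih

  succs-⊆ : ∀ {E : ℕ → Maybe (V G) → Maybe (V G) → Set} w {a b l} → Trail E k a b l →
    map just (mapMaybe (succOf w) (pairs l)) ⊆ l
  succs-⊆ w {l = l} t with head≡ t
  ... | l′ , refl = _ ∷ʳ go _ l′
    where
    go : ∀ a l → map just (mapMaybe (succOf w) (pairs (a ∷ l))) ⊆ l
    go a        []            = []
    go nothing  (b ∷ l)       = b ∷ʳ go b l
    go (just p) (nothing ∷ l) = nothing ∷ʳ go nothing l
    go (just p) (just q ∷ l)  with adj G w p
    ... | true  = refl ∷ go (just q) l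
    ... | false = just q ∷ʳ go (just q) l

  -- Cycles through the extra vertex and their rerouting.

  module _ {x y : V G} where

    -- Hamiltonian paths from x to y become cycles through an extra vertex "nothing" joined to x and y only.
    data Link° : ℕ → Maybe (V G) → Maybe (V G) → Set where
      inner : ∀ {u v} → Link k u v → Link° k (just u) (just v)
      enter : ∀ {v} → v ≡ x ⊎ v ≡ y → Link° 0 nothing (just v)
      leave : ∀ {v} → v ≡ x ⊎ v ≡ y → Link° 0 (just v) nothing

    Link°-sym : ∀ {a b} → Link° k a b → Link° k b a
    Link°-sym (inner e) = inner (Link-sym e)
    Link°-sym (enter e) = leave e
    Link°-sym (leave e) = enter e

    record Cycle (w : ℕ) : Set where
      constructor cycle
      field
        {k₁ k₂}     : ℕ
        {start end} : Maybe (V G)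
        {vertices}  : List (Maybe (V G))
        trail       : Trail Link° k₁ start end vertices
        close       : Link° k₂ end start
        weight≡     : w ≡ k₁ + k₂
        unique      : Unique vertices
        covers      : ∀ v → v ∈ vertices


    -- The two sizes `suc s` and `t` add up to α + 1; thus `s` is one less than the s of the
    -- overview.
    module _ (s t : ℕ) (t≥1 : 1 ≤ t) (s+t : s + t ≡ α) (bip : BipProp G (suc s) t) where

      -- `BipProp` asks for exact cardinalities, so both lists are truncated. Uniqueness of the
      -- concatenation supplies the cardinalities as well as the disjointness.
      bip-lists : ∀ xs ys → Unique (xs ++ ys) → suc s ≤ length xs → t ≤ length ys →
        ∃[ a ] ∃[ b ] (a ∈ xs × b ∈ ys × Adj G a b)
      bip-lists xs ys u s≤ t≤ with bip (fromList (take (suc s) xs)) (fromList (take t ys))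
        (card (suc s) xs (Unique-++⁻ˡ u) s≤) (card t ys (Unique-++⁻ʳ xs u) t≤)
        (λ v p q → Unique-++-disjoint xs u (sub (suc s) xs p) (sub t ys q))
        where
        sub : ∀ m zs {v} → v Subset.∈ fromList (take m zs) → v ∈ zs
        sub m zs p = lookup (take-⊆ m zs) (∈-fromList⁻ (take m zs) p)
        card : ∀ m zs → Unique zs → m ≤ length zs → ∣ fromList (take m zs) ∣ ≡ m
        card m zs u m≤ = trans (∣fromList∣≡ (Unique.take⁺ m u)) (trans (length-take m zs) (m≤n⇒m⊓n≡m m≤))
      ... | a , b , a∈ , b∈ , ab = a , b , lookup (take-⊆ (suc s) xs) (∈-fromList⁻ _ a∈)
                                 , lookup (take-⊆ t ys) (∈-fromList⁻ _ b∈) , ab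

      weight-drop : ∀ i₁ j₁ i₂ j₂ i₃ → i₁ + (0 + (i₂ + (0 + i₃))) + 0 ≤ i₁ + (j₁ + (i₂ + (j₂ + i₃)))
      weight-drop i₁ j₁ i₂ j₂ i₃ = ≤-trans (≤-reflexive (+-identityʳ _))
        (+-monoʳ-≤ i₁ (≤-trans (+-monoʳ-≤ i₂ (m≤n+m i₃ j₂)) (m≤n+m _ j₁)))

      module _ {u v : V G} {l : List (Maybe (V G))} (tr : Trail Link° k (just u) (just v) l)
               (uniq : Unique l) (cov : ∀ w → w ∈ l) where

        -- With segments u...a, a′...b and b′...v, the cycle is a...u, a′...b, v...b′ and back to a.
        -- Its three new links are edges of `G`, so the weight cannot grow.
        cross₁ : ∀ P S {a a′ b b′} → pairs l ≡ P ++ S →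
          (just a , just a′) ∈ P → (just b , just b′) ∈ S →
          Adj G u a′ → Adj G v b → Adj G a b′ → ∃[ k′ ] (k′ ≤ k × Cycle k′)
        cross₁ P S eq p∈ q∈ ua vb ab with split₂ P S tr eq p∈ q∈
        ... | cut₂ {i₁ = i₁} {j₁} {i₂} {j₂} {i₃} {l₁} {l₂} {l₃} t₁ e₁ t₂ e₂ t₃ refl refl =
          _ , weight-drop i₁ j₁ i₂ j₂ i₃ ,
          cycle (join (rev Link°-sym t₁) (inner (edge ua)) (join t₂ (inner (edge (adj-sym vb))) (rev Link°-sym t₃)))
                (inner (edge (adj-sym ab))) refl (Unique-↭ perm uniq) (λ w → ∈-resp-↭ perm (cov w))
          where
          perm : l₁ ++ (l₂ ++ l₃) ↭ reverse l₁ ++ (l₂ ++ reverse l₃)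
          perm = Perm.++⁺ (↭-sym (↭-reverse l₁)) (Perm.++⁺ˡ l₂ (↭-sym (↭-reverse l₃)))

        -- With the same segments, the cycle is u...a, b...a′, v...b′ and back to u.
        cross₂ : ∀ P S {a a′ b b′} → pairs l ≡ P ++ S →
          (just a , just a′) ∈ P → (just b , just b′) ∈ S →
          Adj G v a′ → Adj G u b′ → Adj G a b → ∃[ k′ ] (k′ ≤ k × Cycle k′)
        cross₂ P S eq p∈ q∈ va ub ab with split₂ P S tr eq p∈ q∈
        ... | cut₂ {i₁ = i₁} {j₁} {i₂} {j₂} {i₃} {l₁} {l₂} {l₃} t₁ e₁ t₂ e₂ t₃ refl refl =
          _ , weight-drop i₁ j₁ i₂ j₂ i₃ ,
          cycle (join t₁ (inner (edge ab)) (join (rev Link°-sym t₂) (inner (edge (adj-sym va))) (rev Link°-sym t₃)))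
                (inner (edge (adj-sym ub))) refl (Unique-↭ perm uniq) (λ w → ∈-resp-↭ perm (cov w))
          where
          perm : l₁ ++ (l₂ ++ l₃) ↭ l₁ ++ (reverse l₂ ++ reverse l₃)
          perm = Perm.++⁺ˡ l₁ (Perm.++⁺ (↭-sym (↭-reverse l₂)) (↭-sym (↭-reverse l₃)))

      -- The slack 1 accounts for the neighbour of v lost next to the extra vertex.
      pigeonhole : ∀ {a b} → suc s + t ≤ suc (a + b) → t ≤ b ⊎ suc s ≤ a
      pigeonhole {a} {b} le with t ≤? b | suc s ≤? a
      ... | yes p | _     = inj₁ p
      ... | _     | yes q = inj₂ q
      ... | no p  | no q  = contradiction (s≤s⁻¹ le)
        (<⇒≱ (≤-trans (≤-reflexive (sym (+-suc a b))) (+-mono-≤ (s≤s⁻¹ (≰⇒> q)) (≰⇒> p))))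

      close-missing : ∀ {u v l} → Trail Link° k (just u) (just v) l → Heavy u → Heavy v → ¬ Adj G u v →
        Unique l → (∀ w → w ∈ l) → ∃[ k′ ] (k′ ≤ k × Cycle k′)
      close-missing {k = k} {u = u} {v = v} {l = l} tr hu hv na uniq cov =
        let F , e , S , p , eq , hit , cF = split-at-hit (predOf u) (pairs l) s D>s
        in go F e S p eq hit cF
        where
        -- Of the at least α + 1 neighbours of `u`, at most one follows the extra vertex.
        D≥α : α ≤ count (predOf u) (pairs l)
        D≥α with head≡ tr
        ... | l′ , refl = s≤s⁻¹ (≤-trans hu (≤-trans (deg≤count-nbr u (cov ∘ just))
              (≤-trans (≤-reflexive (count-nbr-∷ l′ (irrefl G u)))
              (≤-trans (count-nbr≤pred u (just u) l′)
              (≤-trans (+-monoʳ-≤ _ (count-hole≤1 uniq)) (≤-reflexive (+-comm _ 1)))))))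
        -- Here `t≥1` is what guarantees a usable neighbour beyond the first `s`.
        D>s : s < count (predOf u) (pairs l)
        D>s = ≤-trans (≤-trans (≤-reflexive (+-comm 1 s)) (+-monoʳ-≤ s t≥1))
                (≤-trans (≤-reflexive s+t) D≥α)
        -- e is the pair ending at the s-th neighbour of u whose predecessor is not the extra vertex.
        go : ∀ F e S p → pairs l ≡ F ++ e ∷ S → predOf u e ≡ just p → count (predOf u) F ≡ s →
             ∃[ k′ ] (k′ ≤ k × Cycle k′)
        go F e S p eq hit cF with predOf⁻ u e hit
        ... | q , refl , uq with split tr eq
        ... | cut {l₁ = l₁} {l₂ = l₂} t₁ _ t₂ refl _ refl refl = result (pigeonhole total)
          where
          -- The head `u` of `l₁` has no predecessor, but it is no neighbour of `v` either, so
          -- dropping it loses nothing.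
          count₁ : count (nbr v) l₁ ≤ count (predOf v) (pairs l₁) + count hole l₁
          count₁ with head≡ t₁
          ... | l′ , refl = ≤-trans (≤-reflexive (count-nbr-∷ l′ (Bool.¬-not (na ∘ adj-sym)))) (count-nbr≤pred v (just u) l′)
          count₂ : count (nbr v) l₂ ≤ count (succOf v) (pairs l₂) + count hole l₂
          count₂ with head≡ t₂
          ... | l′ , refl = count-nbr≤succ v (irrefl G v) t₂
          -- Neighbours of `v` are counted by predecessors left of the cut and by successors right
          -- of it. The extra vertex lies in only one of the two parts, so it costs 1 in total.
          total : suc s + t ≤ suc (count (predOf v) (pairs l₁) + count (succOf v) (pairs l₂))
          total = begin
            suc s + t                                             ≡⟨ cong suc s+t ⟩
            suc α                                                 ≤⟨ hv ⟩
            deg G v                                               ≤⟨ deg≤count-nbr v (cov ∘ just) ⟩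
            count (nbr v) (l₁ ++ l₂)                              ≡⟨ count-++ (nbr v) l₁ ⟩
            count (nbr v) l₁ + count (nbr v) l₂                   ≤⟨ +-mono-≤ count₁ count₂ ⟩
            (a + count hole l₁) + (b + count hole l₂)             ≡⟨ solve 4 (λ a h b h′ → (a :+ h) :+ (b :+ h′) := (h :+ h′) :+ (a :+ b))
                                                                       refl a (count hole l₁) b (count hole l₂) ⟩
            (count hole l₁ + count hole l₂) + (a + b)             ≡⟨ cong (_+ (a + b)) (count-++ hole l₁) ⟨
            count hole (l₁ ++ l₂) + (a + b)                       ≤⟨ +-monoˡ-≤ (a + b) (count-hole≤1 uniq) ⟩
            suc (a + b)                                           ∎
            where
            open ≤-Reasoning
            a = count (predOf v) (pairs l₁)
            b = count (succOf v) (pairs l₂)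
          preds₁ : mapMaybe (predOf u) (pairs l₁ ++ (just p , just q) ∷ []) ≡ mapMaybe (predOf u) (pairs l₁) ++ p ∷ []
          preds₁ = trans (mapMaybe-++ (predOf u) (pairs l₁)) (cong (mapMaybe (predOf u) (pairs l₁) ++_) last-pred)
            where
            last-pred : mapMaybe (predOf u) ((just p , just q) ∷ []) ≡ p ∷ []
            last-pred rewrite hit = refl
          preds₂ : mapMaybe (predOf u) ((just p , just q) ∷ pairs l₂) ≡ p ∷ mapMaybe (predOf u) (pairs l₂)
          preds₂ rewrite hit = refl
          result : t ≤ count (succOf v) (pairs l₂) ⊎ suc s ≤ count (predOf v) (pairs l₁) → ∃[ k′ ] (k′ ≤ k × Cycle k′)
          -- The cut pair is counted on the left: its `p` and the `s` earlier hits make `suc s`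
          -- predecessors in `l₁`, disjoint from the successors in `l₂`.
          result (inj₁ t≤)
            with bip-lists (mapMaybe (predOf u) (pairs l₁ ++ (just p , just q) ∷ [])) (mapMaybe (succOf v) (pairs l₂))
                   (Unique.map⁻ (Unique-⊆ sub uniq))
                   (≤-reflexive (sym (trans (cong length preds₁)
                     (trans (length-++ (mapMaybe (predOf u) (pairs l₁))) (trans (cong (_+ 1) cF) (+-comm s 1)))))) t≤
            where
            sub : map just (mapMaybe (predOf u) (pairs l₁ ++ (just p , just q) ∷ []) ++ mapMaybe (succOf v) (pairs l₂)) ⊆ l₁ ++ l₂
            sub rewrite preds₁ | map-++ just (mapMaybe (predOf u) (pairs l₁) ++ p ∷ []) (mapMaybe (succOf v) (pairs l₂))
                      | map-++ just (mapMaybe (predOf u) (pairs l₁)) (p ∷ []) = ++⁺ (preds-⊆ u t₁) (succs-⊆ v t₂)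
          ... | a , b , a∈ , b∈ , ab with ∈-mapMaybe⁻ (predOf u) (pairs l₁ ++ (just p , just q) ∷ []) a∈ | ∈-mapMaybe⁻ (succOf v) (pairs l₂) b∈
          ... | e₁ , e₁∈ , h₁ | e₂ , e₂∈ , h₂ with predOf⁻ u e₁ h₁ | succOf⁻ v e₂ h₂
          ... | _ , refl , ua | _ , refl , vb =
            cross₁ tr uniq cov (pairs l₁ ++ (just p , just q) ∷ []) (pairs l₂)
              (trans eq (sym (++-assoc (pairs l₁) _ _))) e₁∈ e₂∈ ua vb ab
          -- The cut pair is counted on the right: after the `s` hits before it at least α - s = t
          -- remain. Its `p` lies in `l₁`, but as the last vertex there it is not among the
          -- predecessors from `pairs l₁`.
          result (inj₂ s≤)
            with bip-lists (mapMaybe (predOf v) (pairs l₁)) (mapMaybe (predOf u) ((just p , just q) ∷ pairs l₂))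
                   (Unique.map⁻ (Unique-⊆ sub uniq)) s≤
                   (+-cancelˡ-≤ s _ _ (≤-trans (≤-reflexive s+t) (≤-trans D≥α
                     (≤-reflexive (trans (cong (count (predOf u)) eq)
                       (trans (count-++ (predOf u) (pairs l₁)) (cong (_+ _) cF)))))))
            where
            sub : map just (mapMaybe (predOf v) (pairs l₁) ++ mapMaybe (predOf u) ((just p , just q) ∷ pairs l₂)) ⊆ l₁ ++ l₂
            sub rewrite preds₂ | map-++ just (mapMaybe (predOf v) (pairs l₁)) (p ∷ mapMaybe (predOf u) (pairs l₂)) =
              subst (_⊆ l₁ ++ l₂) (++-assoc (map just (mapMaybe (predOf v) (pairs l₁))) _ _)
                (++⁺ (preds-⊆ v t₁) (⊆-trans (++⁺ʳ (end₂ ∷ []) ⊆-refl) (preds-⊆ u t₂)))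
              where end₂ = just v
          ... | a , b , a∈ , b∈ , ab with ∈-mapMaybe⁻ (predOf v) (pairs l₁) a∈ | ∈-mapMaybe⁻ (predOf u) ((just p , just q) ∷ pairs l₂) b∈
          ... | e₁ , e₁∈ , h₁ | e₂ , e₂∈ , h₂ with predOf⁻ v e₁ h₁ | predOf⁻ u e₂ h₂
          ... | _ , refl , va | _ , refl , ub =
            cross₂ tr uniq cov (pairs l₁) ((just p , just q) ∷ pairs l₂) eq e₁∈ e₂∈ va ub ab

      first-missing : ∀ {a b l} → Trail Link° k a b l → k ≡ 0 ⊎
        ∃[ u ] ∃[ v ] ∃[ i ] ∃[ j ] ∃[ l₁ ] ∃[ l₂ ] (Trail Link° i a (just u) l₁ × Trail Link° j (just v) b l₂ ×
          Heavy u × Heavy v × ¬ Adj G u v × l ≡ l₁ ++ l₂ × k ≡ i + suc j)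
      first-missing [ _ ] = inj₁ refl
      first-missing (inner (missing hu hv na) ∷ t) = inj₂ (_ , _ , _ , _ , _ , _ , [ _ ] , t , hu , hv , na , refl , refl)
      first-missing (inner (edge a) ∷ t) with first-missing t
      ... | inj₁ z = inj₁ z
      ... | inj₂ (_ , _ , _ , _ , _ , _ , t₁ , t₂ , hu , hv , na , refl , eq) =
        inj₂ (_ , _ , _ , _ , _ , _ , inner (edge a) ∷ t₁ , t₂ , hu , hv , na , refl , eq)
      first-missing (enter p ∷ t) with first-missing t
      ... | inj₁ z = inj₁ z
      ... | inj₂ (_ , _ , _ , _ , _ , _ , t₁ , t₂ , hu , hv , na , refl , eq) =
        inj₂ (_ , _ , _ , _ , _ , _ , enter p ∷ t₁ , t₂ , hu , hv , na , refl , eq)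
      first-missing (leave p ∷ t) with first-missing t
      ... | inj₁ z = inj₁ z
      ... | inj₂ (_ , _ , _ , _ , _ , _ , t₁ , t₂ , hu , hv , na , refl , eq) =
        inj₂ (_ , _ , _ , _ , _ , _ , leave p ∷ t₁ , t₂ , hu , hv , na , refl , eq)

      -- Opening the cycle at an added edge removes weight 1, and `close-missing` closes the path
      -- without adding any. The added edge is the closing link if the trail has weight 0; otherwise
      -- the cycle is rotated to make it so.
      lighten : Cycle (suc k) → ∃[ k′ ] (k′ ≤ k × Cycle k′)
      lighten (cycle t e eq u c) with first-missing t
      lighten (cycle t (inner (missing hb ha na)) eq u c) | inj₁ refl with close-missing t ha hb (na ∘ adj-sym) u c
      ... | k′ , le , C = k′ , ≤-trans le z≤n , C
      lighten (cycle t (inner (edge _)) () u c) | inj₁ refl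
      lighten (cycle t (enter _)        () u c) | inj₁ refl
      lighten (cycle t (leave _)        () u c) | inj₁ refl
      lighten {k = k} (cycle {k₂ = k₂} t e eq u c)
        | inj₂ (_ , _ , i , j , l₁ , l₂ , t₁ , t₂ , hu , hv , na , refl , refl)
        with close-missing (join t₂ e t₁) hv hu (na ∘ adj-sym) (Unique-↭ (Perm.++-comm l₁ l₂) u)
               (λ w → ∈-resp-↭ (Perm.++-comm l₁ l₂) (c w))
      ... | k′ , le , C = k′ , ≤-trans le (≤-reflexive (suc-injective (trans
            (solve 3 (λ i j k₂ → con 1 :+ (j :+ (k₂ :+ i)) := (i :+ (con 1 :+ j)) :+ k₂) refl i j k₂) (sym eq)))) , C

      -- A single `lighten` may lower the weight by more than 1, so the recursion runs on the bound
      -- `m`.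
      edge-cycle : ∀ m → k ≤ m → Cycle k → Cycle 0
      edge-cycle {k = zero}  m       _        C = C
      edge-cycle {k = suc k} (suc m) (s≤s le) C with lighten C
      ... | k′ , le′ , C′ = edge-cycle m (≤-trans le′ le) C′

      -- From a cycle without added edges to a Hamiltonian path of `G`.

      trail⇒walk : ∀ {p q l} → Trail Link° k (just p) (just q) l → k ≡ 0 → nothing ∉ l →
        ∃[ vs ] (l ≡ map just vs × Walk G p q vs)
      trail⇒walk [ _ ] z h∉ = _ , refl , single _
      trail⇒walk (inner (edge a) ∷ t) z h∉ with trail⇒walk t z (h∉ ∘ there)
      ... | vs , refl , w = _ , refl , step a w
      trail⇒walk (leave _ ∷ t) z h∉ = contradiction (there (start∈ t)) h∉

      closed-trail : ∀ {a l v} → Trail Link° k (just a) (just a) l → Unique l → just v ∈ l → v ≡ a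
      closed-trail [ _ ]   _       (here refl) = refl
      closed-trail (_ ∷ t) (a ∷ _) _           = contradiction refl (All.lookup a (end∈ t))

      module _ (x≢y : x ≢ y) where

        -- The two neighbours of the extra vertex lie in {x, y}. If they coincided, the path would
        -- be a single vertex and could not cover both `x` and `y`.
        trail⇒HamPath : ∀ {p q l} → Trail Link° 0 (just p) (just q) l → p ≡ x ⊎ p ≡ y → q ≡ x ⊎ q ≡ y →
          nothing ∉ l → Unique l → (∀ v → just v ∈ l) → HamPath G x y
        trail⇒HamPath t (inj₁ refl) (inj₂ refl) h∉ u c with trail⇒walk t refl h∉
        ... | vs , refl , w = vs , w , Unique.map⁻ u , covered
          where
          covered : ∀ v → v ∈ vs
          covered v with ∈-map⁻ just (c v)
          ... | _ , m , refl = m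
        trail⇒HamPath {l = l} t (inj₂ refl) (inj₁ refl) h∉ u c =
          trail⇒HamPath (rev Link°-sym t) (inj₁ refl) (inj₂ refl) (h∉ ∘ ∈-resp-↭ (↭-reverse l))
            (Unique-↭ (↭-sym (↭-reverse l)) u) (λ v → ∈-resp-↭ (↭-sym (↭-reverse l)) (c v))
        trail⇒HamPath t (inj₁ refl) (inj₁ refl) h∉ u c = contradiction (sym (closed-trail t u (c y))) x≢y
        trail⇒HamPath t (inj₂ refl) (inj₂ refl) h∉ u c = contradiction (closed-trail t u (c x)) x≢y

        at-hole : ∀ {b l} → Trail Link° k nothing b l → k ≡ 0 → Link° 0 b nothing → Unique l →
          (∀ v → v ∈ l) → HamPath G x y
        at-hole (enter p ∷ t) refl (leave q) (a ∷ u) c =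
          trail⇒HamPath t p q (λ m → All.lookup a m refl) u drop-hole
          where
          drop-hole : ∀ v → just v ∈ _
          drop-hole v with c (just v)
          ... | there m = m

        reach : ∀ {a b w l} → Trail Link° k a b l → w ∈ l → (w ≡ a) ⊎
          ∃[ p ] ∃[ i₁ ] ∃[ j ] ∃[ i₂ ] ∃[ l₁ ] ∃[ l₂ ] (Trail Link° i₁ a p l₁ × Link° j p w × Trail Link° i₂ w b l₂ ×
            l ≡ l₁ ++ l₂ × k ≡ i₁ + (j + i₂))
        reach [ _ ]   (here refl) = inj₁ refl
        reach (e ∷ t) (here refl) = inj₁ refl
        reach (_∷_ {i = i} e t) (there m) with reach t m
        ... | inj₁ refl = inj₂ (_ , _ , _ , _ , _ , _ , [ _ ] , e , t , refl , refl)
        ... | inj₂ (_ , i₁ , j , i₂ , _ , _ , t₁ , f , t₂ , refl , refl) =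
          inj₂ (_ , _ , _ , _ , _ , _ , e ∷ t₁ , f , t₂ , refl , sym (+-assoc i i₁ (j + i₂)))

        cycle⇒HamPath : Cycle 0 → HamPath G x y
        cycle⇒HamPath (cycle {k₁ = zero} {k₂ = zero} t e eq u c) with reach t (c nothing)
        ... | inj₁ refl = at-hole t refl e u c
        ... | inj₂ (_ , zero , zero , zero , l₁ , l₂ , t₁ , f , t₂ , refl , refl) =
          at-hole (join t₂ e t₁) refl f (Unique-↭ (Perm.++-comm l₁ l₂) u) (λ w → ∈-resp-↭ (Perm.++-comm l₁ l₂) (c w))

        HamPath-closure : ∀ {l} → Trail Link k x y l → Unique l → (∀ v → v ∈ l) → HamPath G x y
        HamPath-closure {k = k} {l = l} t u c = cycle⇒HamPath (edge-cycle k ≤-refl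
          (cycle (enter (inj₁ refl) ∷ lift t) (leave (inj₂ refl)) (sym (+-identityʳ k))
            (All.tabulate (fresh l) ∷ Unique.map⁺ just-injective u) covered))
          where
          lift : ∀ {a b l} → Trail Link j a b l → Trail Link° j (just a) (just b) (map just l)
          lift [ _ ]   = [ _ ]
          lift (e ∷ t) = inner e ∷ lift t
          fresh : ∀ l {w : Maybe (V G)} → w ∈ map just l → nothing ≢ w
          fresh (_ ∷ l) (here refl) ()
          fresh (_ ∷ l) (there m)   = fresh l m
          covered : ∀ w → w ∈ nothing ∷ map just l
          covered nothing  = here refl
          covered (just v) = there (∈-map⁺ just (c v))

-- Light vertices and their cliques.

module Light (G : Graph) (conn : KConnected 3 G) (α : ℕ)
  (fan : ∀ x y → x ≢ y → ¬ Adj G x y → Dist G x y 2 → deg G x ⊔ deg G y ≥ suc α) where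

  open Closure G α
  open import Data.List.Membership.DecPropositional (_≟_ {Graph.n G}) using (_∈?_)

  private variable
    u v w x y a b c d : V G
    l L L₁ L₂ R P : List (V G)

  heavy? : Decidable Heavy
  heavy? v = suc α ≤? deg G v

  adj? : ∀ u v → Dec (Adj G u v)
  adj? u v = adj G u v Bool.≟ true

  Light : V G → Set
  Light v = ¬ Heavy v

  light≢heavy : Light u → Heavy v → u ≢ v
  light≢heavy lu hv refl = lu hv

  -- Otherwise `u` and `v` are at distance 2 through `w`, and `fan` makes one of them heavy.
  adj-common : Light u → Light v → u ≢ v → Adj G w u → Adj G w v → Adj G u v
  adj-common {u} {v} {w} lu lv u≢v wu wv with adj? u v
  ... | yes uv = uv
  ... | no ¬uv = contradiction (fan u v u≢v ¬uv ((_ , step (adj-sym wu) (step wv (single v)) , refl) , far))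
                   (<⇒≱ (s≤s (⊔-lub (s≤s⁻¹ (≰⇒> lu)) (s≤s⁻¹ (≰⇒> lv)))))
    where
    far : ∀ vs → Walk G u v vs → 2 ≤ walkLength vs
    far _ (single _)                   = contradiction refl u≢v
    far _ (step uv (single _))         = contradiction uv ¬uv
    far _ (step _ (step _ (single _))) = s≤s (s≤s z≤n)
    far _ (step _ (step _ (step _ _))) = s≤s (s≤s z≤n)

  -- v ~ w says that v and w lie in the same light clique.
  _~_ : V G → V G → Set
  w ~ v = Light w × Light v × (v ≡ w ⊎ Adj G w v)

  ~-refl : Light w → w ~ w
  ~-refl lw = lw , lw , inj₁ refl

  ~-sym : w ~ v → v ~ w
  ~-sym (lw , lv , inj₁ refl) = lv , lw , inj₁ refl
  ~-sym (lw , lv , inj₂ wv)   = lv , lw , inj₂ (adj-sym wv)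

  ~-adj : a ~ b → a ≢ b → Adj G a b
  ~-adj (_ , _ , inj₁ refl) ne = contradiction refl ne
  ~-adj (_ , _ , inj₂ ab)   ne = ab

  ~-common : Light a → Light b → Adj G w a → Adj G w b → a ~ b
  ~-common {a} {b} la lb wa wb with a ≟ b
  ... | yes refl = ~-refl la
  ... | no a≢b   = la , lb , inj₂ (adj-common la lb a≢b wa wb)

  -- The middle vertex is a common neighbour of the outer two. Hence `~` is an equivalence on the
  -- light vertices whose classes are cliques.
  ~-trans : w ~ a → a ~ b → w ~ b
  ~-trans (lw , _ , inj₁ refl) ab                    = ab
  ~-trans wa                   (_ , _ , inj₁ refl)   = wa
  ~-trans (lw , _ , inj₂ wa)   (_ , lb , inj₂ ab) = ~-common lw lb (adj-sym wa) ab

  ~-step : w ~ a → Light b → Adj G a b → w ~ b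
  ~-step wa@(_ , la , _) lb ab = ~-trans wa (la , lb , inj₂ ab)

  ~? : ∀ w → Decidable (w ~_)
  ~? w v = ¬? (heavy? w) ×-dec (¬? (heavy? v) ×-dec ((v ≟ w) ⊎-dec adj? w v))

  -- Paths of `G′` running through cliques.

  Linked : V G → V G → Set
  Linked u v = ∃[ k ] Link k u v

  heavy-linked : Heavy u → Heavy v → Linked u v
  heavy-linked {u} {v} hu hv with adj? u v
  ... | yes uv = 0 , edge uv
  ... | no ¬uv = 1 , missing hu hv ¬uv

  Path : V G → V G → List (V G) → Set
  Path a b l = ∃[ k ] Trail Link k a b l

  path-join : Path a b l → Linked b c → Path c d L → Path a d (l ++ L)
  path-join (_ , s) (_ , e) (_ , t) = _ , join s e t

  path-rev : Path a b l → Path b a (reverse l)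
  path-rev (_ , t) = _ , rev Link-sym t

  Clique : (V G → Set) → Set
  Clique C = ∀ {a b} → C a → C b → a ≢ b → Linked a b

  -- The members of `R` are appended to the left path one at a time. `Clique` links only distinct
  -- vertices, and uniqueness of the whole list provides the distinctness.
  clique-join : ∀ {C : V G → Set} → Clique C → Path a c L₁ → C c → All C R → C d → Path d b L₂ →
    Unique (L₁ ++ R ++ L₂) → Path a b (L₁ ++ R ++ L₂)
  clique-join {L₁ = L₁} {R = []} cl s Cc [] Cd t u =
    path-join s (cl Cc Cd (λ { refl → Unique-++-disjoint L₁ u (end∈ (proj₂ s)) (start∈ (proj₂ t)) })) t
  clique-join {L₁ = L₁} {R = r ∷ R} {L₂ = L₂} cl s Cc (Cr ∷ CR) Cd t u =
    subst (Path _ _) (++-assoc L₁ (r ∷ []) (R ++ L₂))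
      (clique-join {L₁ = L₁ ++ r ∷ []} cl
        (path-join s (cl Cc Cr (λ { refl → Unique-++-disjoint L₁ u (end∈ (proj₂ s)) (here refl) })) (_ , [ r ]))
        Cr CR Cd t (subst Unique (sym (++-assoc L₁ (r ∷ []) (R ++ L₂))) u))

  -- A Hamiltonian path of a clique with prescribed ends; equal ends are possible only when the
  -- clique has one element.
  span : ∀ {C : V G → Set} → Decidable C → Clique C → C a → C b → (a ≡ b → ∀ v → C v → v ≡ a) →
    ∃[ L ] (Path a b L × Unique L × (∀ {v} → C v → v ∈ L) × (∀ {v} → v ∈ L → C v))
  span {a} {b} {C} C? cl Ca Cb only with a ≟ b
  ... | yes refl = a ∷ [] , (_ , [ a ]) , [] ∷ [] , (λ {v} Cv → here (only refl v Cv)) , λ { (here refl) → Ca }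
  ... | no a≢b = a ∷ rest ++ b ∷ [] ,
      clique-join {L₁ = a ∷ []} cl (_ , [ a ]) Ca (All.tabulate (proj₁ ∘ rest⁻)) Cb (_ , [ b ]) uniq , uniq ,
      into , out
    where
    Rest : V G → Set
    Rest v = C v × (v ≢ a × v ≢ b)
    rest? : Decidable Rest
    rest? v = C? v ×-dec (¬? (v ≟ a) ×-dec ¬? (v ≟ b))
    rest : List (V G)
    rest = filter rest? (allFin _)
    rest⁻ : v ∈ rest → Rest v
    rest⁻ m = proj₂ (∈-filter⁻ rest? {xs = allFin _} m)
    out : v ∈ a ∷ rest ++ b ∷ [] → C v
    out (here refl) = Ca
    out (there m) with ∈-++⁻ rest m
    ... | inj₁ m′          = proj₁ (rest⁻ m′)
    ... | inj₂ (here refl) = Cb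
    into : C v → v ∈ a ∷ rest ++ b ∷ []
    into {v} Cv with v ≟ a | v ≟ b
    ... | yes refl | _        = here refl
    ... | no _     | yes refl = there (∈-++⁺ʳ rest (here refl))
    ... | no v≢a   | no v≢b   = there (∈-++⁺ˡ (∈-filter⁺ rest? (∈-allFin v) (Cv , v≢a , v≢b)))
    uniq : Unique (a ∷ rest ++ b ∷ [])
    uniq = All.tabulate fresh ∷ Unique.++⁺ (Unique.filter⁺ rest? (Unique.allFin⁺ _)) ([] ∷ [])
             λ { (m , here refl) → proj₂ (proj₂ (rest⁻ m)) refl }
      where
      fresh : v ∈ rest ++ b ∷ [] → a ≢ v
      fresh m refl with ∈-++⁻ rest m
      ... | inj₁ m′         = proj₁ (proj₂ (rest⁻ m′)) refl
      ... | inj₂ (here a≡b) = a≢b a≡b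

  -- Edges leaving a light clique, from 3-connectivity.

  walk-exit : ∀ {C Q : V G → Set} {vs} → Decidable C → Walk G u v vs → All Q vs → C u → ¬ C v →
    ∃[ a ] ∃[ b ] (C a × ¬ C b × Adj G a b × Q a × Q b)
  walk-exit C? (single _) _ Cu ¬Cv = contradiction Cu ¬Cv
  walk-exit C? (step {z = z} uz wk) (qu ∷ q) Cu ¬Cv with C? z
  ... | yes Cz = walk-exit C? wk q Cz ¬Cv
  ... | no ¬Cz = _ , _ , Cu , ¬Cz , uz , qu , head-All wk q
    where
    head-All : ∀ {Q z v vs} → Walk G z v vs → All Q vs → Q z
    head-All (single _) (q ∷ _) = q
    head-All (step _ _) (q ∷ _) = q

  -- The case `c ≡ d` is allowed and then deletes a single vertex; it is used below to avoid `y`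
  -- alone.
  walk-avoiding : ∀ c d → u ≢ c → u ≢ d → v ≢ c → v ≢ d →
    ∃[ vs ] (Walk G u v vs × All (λ z → z ≢ c × z ≢ d) vs)
  walk-avoiding c d u≢c u≢d v≢c v≢d with proj₂ conn (fromList (c ∷ d ∷ [])) (s≤s (∣fromList∣≤ (c ∷ d ∷ [])))
    _ _ (out u≢c u≢d) (out v≢c v≢d)
    where
    out : ∀ {u} → u ≢ c → u ≢ d → u Subset.∉ fromList (c ∷ d ∷ [])
    out u≢c u≢d m with ∈-fromList⁻ (c ∷ d ∷ []) m
    ... | here eq         = u≢c eq
    ... | there (here eq) = u≢d eq
  ... | vs , wk , q = vs , wk , All.map (λ nm → (λ { refl → nm (∈-fromList⁺ {xs = c ∷ d ∷ []} (here refl)) })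
                                              , (λ { refl → nm (∈-fromList⁺ {xs = c ∷ d ∷ []} (there (here refl))) })) q

  -- An edge from the clique of `w` to a heavy vertex that survives the deletion of `c` and `d`,
  -- whether these are light or heavy.
  record Exit (w c d : V G) : Set where
    constructor exit
    field
      {from to} : V G
      w~from    : w ~ from
      hvy       : Heavy to
      link      : Adj G from to
      from≢c    : from ≢ c
      from≢d    : from ≢ d
      to≢c      : to ≢ c
      to≢d      : to ≢ d

  not-self : ∀ v → ¬ Adj G v v
  not-self v vv with trans (sym vv) (irrefl G v)
  ... | ()

  suc-deg≤n : ∀ v → suc (deg G v) ≤ Graph.n G
  suc-deg≤n v = subst (_≤ _) (∣insert∣≡ v (N G v) (not-self v ∘ ∈-N⁻)) (Subset.∣p∣≤n (insert v (N G v)))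

  nonadjacent⇒deg : u ≢ v → ¬ Adj G v u → suc (suc (deg G v)) ≤ Graph.n G
  nonadjacent⇒deg {u} {v} u≢v ¬vu =
    subst (_≤ _) (trans (∣insert∣≡ u _ u∉) (cong suc (∣insert∣≡ v (N G v) (not-self v ∘ ∈-N⁻))))
      (Subset.∣p∣≤n (insert u (insert v (N G v))))
    where
    u∉ : u Subset.∉ insert v (N G v)
    u∉ m with ∈-insert⁻ v (N G v) m
    ... | inj₁ eq = u≢v eq
    ... | inj₂ q  = ¬vu (∈-N⁻ q)

  n≤∣_∣ : ∀ (S : Subset (Graph.n G)) → (∀ v → v Subset.∈ S) → Graph.n G ≤ ∣ S ∣
  n≤∣ S ∣ all = subst (_≤ ∣ S ∣) (Subset.∣⊤∣≡n (Graph.n G)) (Subset.p⊆q⇒∣p∣≤∣q∣ {p = Subset.⊤} (λ {v} _ → all v))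

  connected : ∀ u v → ∃[ vs ] Walk G u v vs
  connected u v with proj₂ conn Subset.⊥ (subst (_< 3) (sym (Subset.∣⊥∣≡0 (Graph.n G))) (s≤s z≤n)) u v Subset.∉⊥ Subset.∉⊥
  ... | vs , wk , _ = vs , wk

  -- Suppose otherwise. Deleting `c` and `d` leaves only light vertices, so these form one clique,
  -- and some `k` in it has a heavy neighbour `h`. Only `k`, its neighbours and the remaining heavy
  -- vertex `o` exist, so n ≤ α + 2, and every heavy vertex, having degree above α, is adjacent to
  -- all others. Then so is `k`, giving n ≤ α + 1 against the degree of `h`.
  ¬two-heavies : ∀ {k₀} → Heavy c → Heavy d → (∀ h → Heavy h → h ≡ c ⊎ h ≡ d) → ¬ Light k₀
  ¬two-heavies {c} {d} {k₀} hc hd only l₀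
    with walk-exit (~? k₀) (proj₂ (connected k₀ c)) (All.universal (λ _ → tt) _) (~-refl l₀) (λ { (_ , lc , _) → lc hc })
  ... | k , h , k₀k@(_ , lk , _) , ¬k₀h , kh , _ = contradiction (≤-trans (s≤s hh) (suc-deg≤n h))
          (<⇒≱ (s≤s (≤-trans (n≤∣ insert k (N G k) ∣ full) (≤-trans (∣insert∣≤ k (N G k)) (s≤s deg-k≤α)))))
    where
    hh : Heavy h
    hh = decidable-stable (heavy? h) (λ lh → ¬k₀h (~-step k₀k lh kh))
    deg-k≤α : deg G k ≤ α
    deg-k≤α = s≤s⁻¹ (≰⇒> lk)
    all-lights : ∀ v → Light v → k₀ ~ v
    all-lights v lv = decidable-stable (~? k₀ v) escape
      where
      escape : ¬ ¬ (k₀ ~ v)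
      escape ¬k₀v with walk-avoiding c d (light≢heavy l₀ hc) (light≢heavy l₀ hd) (light≢heavy lv hc) (light≢heavy lv hd)
      ... | vs , wlk , q with walk-exit (~? k₀) wlk q (~-refl l₀) ¬k₀v
      ... | a , b , k₀a , ¬k₀b , ab , _ , (b≢c , b≢d) = ¬k₀b (~-step k₀a (λ hb → [ b≢c , b≢d ]′ (only b hb)) ab)
    other : ∃[ o ] (∀ g → Heavy g → g ≡ h ⊎ g ≡ o)
    other with only h hh
    ... | inj₁ refl = d , only
    ... | inj₂ refl = c , λ g hg → [ inj₂ , inj₁ ]′ (only g hg)
    o : V G
    o = proj₁ other
    k~v : ∀ v → Light v → k ~ v
    k~v v lv = ~-trans (~-sym k₀k) (all-lights v lv)
    all-but-o : ∀ v → v Subset.∈ insert k (insert o (N G k))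
    all-but-o v with v ≟ k | heavy? v
    ... | yes refl | _      = ∈-insert k _
    ... | no v≢k   | no lv  = insert-⊆ k _ (insert-⊆ o _ (∈-N⁺ (~-adj (k~v v lv) (v≢k ∘ sym))))
    ... | no v≢k   | yes hv with proj₂ other v hv
    ...   | inj₁ refl = insert-⊆ k _ (insert-⊆ o _ (∈-N⁺ kh))
    ...   | inj₂ refl = insert-⊆ k _ (∈-insert o _)
    n≤2+α : Graph.n G ≤ suc (suc α)
    n≤2+α = ≤-trans (n≤∣ insert k (insert o (N G k)) ∣ all-but-o)
      (≤-trans (∣insert∣≤ k (insert o (N G k))) (s≤s (≤-trans (∣insert∣≤ o (N G k)) (s≤s deg-k≤α))))
    heavy-universal : ∀ g v → Heavy g → v ≢ g → Adj G g v
    heavy-universal g v hg v≢g = decidable-stable (adj? g v) λ ¬gv →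
      <⇒≱ (s≤s (s≤s hg)) (≤-trans (nonadjacent⇒deg v≢g ¬gv) n≤2+α)
    full : ∀ v → v Subset.∈ insert k (N G k)
    full v with v ≟ k | heavy? v
    ... | yes refl | _      = ∈-insert k _
    ... | no v≢k   | no lv  = insert-⊆ k _ (∈-N⁺ (~-adj (k~v v lv) (v≢k ∘ sym)))
    ... | no v≢k   | yes hv = insert-⊆ k _ (∈-N⁺ (adj-sym (heavy-universal v k hv (v≢k ∘ sym))))

  -- If all heavy vertices were among `c` and `d`, then `¬two-heavies` applies, with a light one of
  -- the two replaced by the other; if both are light, `g₀` is the contradiction.
  third-heavy : ∀ {k₀ g₀} → Light k₀ → Heavy g₀ → ∀ c d → ∃[ h ] (Heavy h × h ≢ c × h ≢ d)
  third-heavy {g₀ = g₀} l₀ hg₀ c d with any? (λ h → heavy? h ×-dec (¬? (h ≟ c) ×-dec ¬? (h ≟ d)))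
  ... | yes found = found
  ... | no none = contradiction l₀ (impossible (heavy? c) (heavy? d))
    where
    only : ∀ h → Heavy h → h ≡ c ⊎ h ≡ d
    only h hh with h ≟ c | h ≟ d
    ... | yes p | _     = inj₁ p
    ... | _     | yes q = inj₂ q
    ... | no p  | no q  = contradiction (h , hh , p , q) none
    impossible : Dec (Heavy c) → Dec (Heavy d) → ¬ Light _
    impossible (yes hc) (yes hd) = ¬two-heavies hc hd only
    impossible (yes hc) (no ld)  = ¬two-heavies hc hc λ h hh → inj₁
      ([ (λ p → p) , (λ { refl → contradiction hh ld }) ]′ (only h hh))
    impossible (no lc)  (yes hd) = ¬two-heavies hd hd λ h hh → inj₂
      ([ (λ { refl → contradiction hh lc }) , (λ p → p) ]′ (only h hh))
    impossible (no lc)  (no ld) _ with only g₀ hg₀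
    ... | inj₁ refl = lc hg₀
    ... | inj₂ refl = ld hg₀

  abstract
    -- Follow a walk avoiding `c` and `d` to a third heavy vertex. Where it first leaves the clique
    -- the next vertex is heavy, since a light one would belong to the clique.
    find-exit : ∀ {k₀ g₀} → Heavy g₀ → ∀ c d → w ~ k₀ → k₀ ≢ c → k₀ ≢ d → Exit w c d
    find-exit {w} hg₀ c d wk@(lw , _) k≢c k≢d with third-heavy lw hg₀ c d
    ... | g , hg , g≢c , g≢d with walk-avoiding c d k≢c k≢d g≢c g≢d
    ... | vs , wlk , q with walk-exit (~? w) wlk q wk (λ { (_ , lg , _) → lg hg })
    ... | a , b , wa , ¬wb , ab , (a≢c , a≢d) , (b≢c , b≢d) =
      exit wa (decidable-stable (heavy? b) (λ lb → ¬wb (~-step wa lb ab))) ab a≢c a≢d b≢c b≢d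

  -- A first saturated path, placing the cliques of `x` and `y`.

  -- A path through all heavy vertices which covers every light clique that it meets.
  record Saturated (x y : V G) : Set where
    constructor saturated
    field
      {vertices} : List (V G)
      path       : Path x y vertices
      unique     : Unique vertices
      heavies    : ∀ {v} → Heavy v → v ∈ vertices
      closed     : ∀ {v w} → v ∈ vertices → v ~ w → w ∈ vertices

  Saturated-sym : Saturated x y → Saturated y x
  Saturated-sym (saturated {vs} p u h c) =
    saturated (path-rev p) (Unique-↭ (↭-sym (↭-reverse vs)) u) (to ∘ h) (λ m → to ∘ c (from m))
    where
    to : v ∈ vs → v ∈ reverse vs
    to = ∈-resp-↭ (↭-sym (↭-reverse vs))
    from : v ∈ reverse vs → v ∈ vs
    from = ∈-resp-↭ (↭-reverse vs)

  assemble : Path x c L₁ → Path d y L₂ → Heavy c → Heavy d → Unique (L₁ ++ L₂) →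
    (∀ {v w} → v ∈ L₁ ++ L₂ → v ~ w → w ∈ L₁ ++ L₂) → Saturated x y
  assemble {L₁ = L₁} {L₂ = L₂} s t hc hd u cl =
    saturated (clique-join {C = Heavy} (λ hu hv _ → heavy-linked hu hv) s hc (All.tabulate (proj₁ ∘ rest⁻)) hd t uniq) uniq heavies closed
    where
    Rest : V G → Set
    Rest v = Heavy v × v ∉ L₁ ++ L₂
    rest? : Decidable Rest
    rest? v = heavy? v ×-dec ¬? (v ∈? L₁ ++ L₂)
    rest : List (V G)
    rest = filter rest? (allFin _)
    rest⁻ : v ∈ rest → Rest v
    rest⁻ m = proj₂ (∈-filter⁻ rest? {xs = allFin _} m)
    perm : rest ++ (L₁ ++ L₂) ↭ L₁ ++ (rest ++ L₂)
    perm = Perm.shifts rest L₁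
    uniq : Unique (L₁ ++ rest ++ L₂)
    uniq = Unique-↭ perm (Unique.++⁺ (Unique.filter⁺ rest? (Unique.allFin⁺ _)) u
             (λ { (m , m′) → proj₂ (rest⁻ m) m′ }))
    old : v ∈ L₁ ++ L₂ → v ∈ L₁ ++ rest ++ L₂
    old m = ∈-resp-↭ perm (∈-++⁺ʳ rest m)
    heavies : Heavy v → v ∈ L₁ ++ rest ++ L₂
    heavies {v} hv with v ∈? L₁ ++ L₂
    ... | yes m = old m
    ... | no v∉ = ∈-resp-↭ perm (∈-++⁺ˡ (∈-filter⁺ rest? (∈-allFin v) (hv , v∉)))
    closed : v ∈ L₁ ++ rest ++ L₂ → v ~ w → w ∈ L₁ ++ rest ++ L₂
    closed m vw@(lv , _) with ∈-++⁻ rest (∈-resp-↭ (↭-sym perm) m)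
    ... | inj₁ m′ = contradiction (proj₁ (rest⁻ m′)) lv
    ... | inj₂ m′ = old (cl m′ vw)

  ~-linked : ∀ {C : V G → Set} → (∀ {v} → C v → w ~ v) → Clique C
  ~-linked sub Ca Cb a≢b = 0 , edge (~-adj (~-trans (~-sym (sub Ca)) (sub Cb)) a≢b)

  -- Remembers how the heavy end of an arm was reached, so that the arms of `x` and `y` can be told
  -- apart.
  Origin : V G → V G → Set
  Origin x h = h ≡ x ⊎ ∃[ k ] (x ~ k × Adj G k h)

  -- A vertex adjacent to both cliques would be a common neighbour of two light vertices and merge
  -- the cliques.
  origins-disjoint : ∀ {h} → ¬ x ~ y → h ≢ y → h ≢ x → Origin x h → ¬ Origin y h
  origins-disjoint ¬xy h≢y h≢x (inj₁ h≡x) _          = h≢x h≡x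
  origins-disjoint ¬xy h≢y h≢x _          (inj₁ h≡y) = h≢y h≡y
  origins-disjoint ¬xy h≢y h≢x (inj₂ (k , xk@(_ , lk , _) , kh)) (inj₂ (k′ , yk′@(_ , lk′ , _) , k′h)) =
    ¬xy (~-trans xk (~-trans (~-common lk lk′ (adj-sym kh) (adj-sym k′h)) (~-sym yk′)))

  -- An initial piece of the path: a heavy `x` alone, or the whole clique of a light `x` followed by
  -- a heavy neighbour of it.
  record Arm (x y : V G) : Set where
    constructor arm
    field
      {h}    : V G
      {vertices} : List (V G)
      path   : Path x h vertices
      unique : Unique vertices
      hvy    : Heavy h
      h≢y    : h ≢ y
      origin : Origin x h
      sound  : ∀ {v} → v ∈ vertices → v ≡ h ⊎ x ~ v
      covers : ∀ {v} → x ~ v → v ∈ vertices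

  make-arm : ∀ {g₀} → Heavy g₀ → x ≢ y → ¬ x ~ y → Arm x y
  make-arm {x} {y} hg₀ x≢y ¬xy with heavy? x
  ... | yes hx = arm (_ , [ x ]) ([] ∷ []) hx x≢y (inj₁ refl) (λ { (here eq) → inj₁ eq })
                   (λ { (lx , _) → contradiction hx lx })
  ... | no lx = from-exit (any? (λ v → ~? x v ×-dec ¬? (v ≟ x)))
    where
    build : ∀ {k h} → x ~ k → (x ≡ k → ∀ v → x ~ v → v ≡ x) → Heavy h → Adj G k h → h ≢ y → Arm x y
    build {k} {h} xk only hh kh h≢y with span {C = x ~_} (~? x) (~-linked (λ p → p)) (~-refl lx) xk only
    ... | L , p , u , into , out = arm (path-join p (0 , edge kh) (_ , [ h ]))
        (Unique.++⁺ u ([] ∷ []) (λ { (m , here refl) → proj₁ (proj₂ (out m)) hh }))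
        hh h≢y (inj₂ (k , xk , kh)) sound (∈-++⁺ˡ ∘ into)
      where
      sound : v ∈ L ++ h ∷ [] → v ≡ h ⊎ x ~ v
      sound m with ∈-++⁻ L m
      ... | inj₁ m′        = inj₂ (out m′)
      ... | inj₂ (here eq) = inj₁ eq
    from-exit : Dec (∃[ v ] (x ~ v × v ≢ x)) → Arm x y
    -- Deleting `x` forces the exit to start at another member, so a path from `x` to it can cover
    -- the clique.
    from-exit (yes (k₀ , xk₀ , k₀≢x)) with find-exit hg₀ x y xk₀ k₀≢x (λ { refl → ¬xy xk₀ })
    ... | exit xk hh kh k≢x _ _ h≢y = build xk (λ { refl → contradiction refl k≢x }) hh kh h≢y
    -- The clique is just `x`, which must be kept; giving `y` twice deletes `y` only.
    from-exit (no alone) with find-exit hg₀ y y (~-refl lx) x≢y x≢y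
    ... | exit {from = k} xk hh kh _ _ h≢y _ =
      build xk (λ _ v xv → decidable-stable (v ≟ x) (λ v≢x → alone (v , xv , v≢x))) hh kh h≢y

  saturated-apart : ∀ {g₀} → Heavy g₀ → x ≢ y → ¬ x ~ y → Saturated x y
  saturated-apart {x} {y} hg₀ x≢y ¬xy with make-arm hg₀ x≢y ¬xy | make-arm hg₀ (x≢y ∘ sym) (¬xy ∘ ~-sym)
  ... | arm {h} {L} p u hh h≢y o s c | arm {h′} {L′} p′ u′ hh′ h′≢x o′ s′ c′ =
    assemble p (path-rev p′) hh hh′
      (Unique.++⁺ u (Unique-↭ (↭-sym (↭-reverse L′)) u′) (λ { (m , m′) → disjoint m (from m′) })) closed
    where
    from : v ∈ reverse L′ → v ∈ L′
    from = ∈-resp-↭ (↭-reverse L′)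
    to : v ∈ L′ → v ∈ reverse L′
    to = ∈-resp-↭ (↭-sym (↭-reverse L′))
    h≢h′ : h ≢ h′
    h≢h′ refl = origins-disjoint ¬xy h≢y h′≢x o o′
    disjoint : v ∈ L → v ∉ L′
    disjoint m m′ with s m | s′ m′
    ... | inj₁ refl         | inj₁ eq           = h≢h′ eq
    ... | inj₁ refl         | inj₂ (_ , lv , _) = lv hh
    ... | inj₂ (_ , lv , _) | inj₁ refl         = lv hh′
    ... | inj₂ xv           | inj₂ yv           = ¬xy (~-trans xv (~-sym yv))
    closed : v ∈ L ++ reverse L′ → v ~ w → w ∈ L ++ reverse L′
    closed m vw@(lv , _) with ∈-++⁻ L m
    ... | inj₁ m₁ with s m₁
    ...   | inj₁ refl = contradiction hh lv
    ...   | inj₂ xv   = ∈-++⁺ˡ (c (~-trans xv vw))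
    closed m vw@(lv , _) | inj₂ m₂ with s′ (from m₂)
    ...   | inj₁ refl = contradiction hh′ lv
    ...   | inj₂ yv   = ∈-++⁺ʳ L (to (c′ (~-trans yv vw)))

  -- The common clique is divided: the path covers everything but `k′` and `y` on its way from `x`
  -- to `k`, leaves to `h`, and finally comes back through `h′`, `k′`, `y`. The last two may
  -- coincide.
  two-armed : ∀ {k h k′ h′} → x ≢ y → x ~ y → x ~ k → x ~ k′ → k ≢ k′ → k ≢ y → k′ ≢ x →
    (x ≡ k → ∀ v → x ~ v → v ≢ y → v ≡ x) → Adj G k h → Adj G k′ h′ → Heavy h → Heavy h′ → h ≢ h′ →
    Saturated x y
  two-armed {x} {y} {k} {h} {k′} {h′} x≢y xy@(lx , _) xk xk′ k≢k′ k≢y k′≢x only kh k′h′ hh hh′ h≢h′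
    with span {C = λ v → x ~ v × (v ≢ y × v ≢ k′)} (λ v → ~? x v ×-dec (¬? (v ≟ y) ×-dec ¬? (v ≟ k′)))
           (~-linked proj₁) (~-refl lx , x≢y , k′≢x ∘ sym) (xk , k≢y , k≢k′)
           (λ eq v (xv , v≢y , _) → only eq v xv v≢y)
       | span {C = λ v → v ≡ k′ ⊎ v ≡ y} (λ v → (v ≟ k′) ⊎-dec (v ≟ y))
           (~-linked (λ { (inj₁ refl) → xk′ ; (inj₂ refl) → xy })) (inj₁ refl) (inj₂ refl)
           (λ { refl v (inj₁ eq) → eq ; refl v (inj₂ eq) → eq })
  ... | L , p , u , into , out | L′ , p′ , u′ , into′ , out′ =
    assemble (path-join p (0 , edge kh) (_ , [ h ])) (path-join (_ , [ h′ ]) (0 , edge (adj-sym k′h′)) p′) hh hh′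
      (Unique.++⁺ (Unique.++⁺ u ([] ∷ []) (λ { (m , here refl) → light∈ (proj₁ (out m)) hh }))
        (All.tabulate (λ { m refl → light∈ (in′ (out′ m)) hh′ }) ∷ u′) (λ { (m , m′) → disjoint m m′ }))
      closed
    where
    light∈ : x ~ v → Light v
    light∈ (_ , lv , _) = lv
    in′ : v ≡ k′ ⊎ v ≡ y → x ~ v
    in′ (inj₁ refl) = xk′
    in′ (inj₂ refl) = xy
    disjoint : v ∈ L ++ h ∷ [] → v ∉ h′ ∷ L′
    disjoint m m′ with ∈-++⁻ L m
    disjoint m (here refl) | inj₁ m₁          = light∈ (proj₁ (out m₁)) hh′
    disjoint m (here refl) | inj₂ (here refl) = h≢h′ refl
    disjoint m (there m′)  | inj₂ (here refl) = light∈ (in′ (out′ m′)) hh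
    disjoint m (there m′)  | inj₁ m₁ with out m₁ | out′ m′
    ... | _ , _ , v≢k′ | inj₁ eq = v≢k′ eq
    ... | _ , v≢y , _  | inj₂ eq = v≢y eq
    covers : x ~ v → v ∈ (L ++ h ∷ []) ++ h′ ∷ L′
    covers {v} xv with v ≟ y | v ≟ k′
    ... | yes eq | _      = ∈-++⁺ʳ (L ++ h ∷ []) (there (into′ (inj₂ eq)))
    ... | no _   | yes eq = ∈-++⁺ʳ (L ++ h ∷ []) (there (into′ (inj₁ eq)))
    ... | no v≢y | no v≢k′ = ∈-++⁺ˡ (∈-++⁺ˡ (into (xv , v≢y , v≢k′)))
    closed : v ∈ (L ++ h ∷ []) ++ h′ ∷ L′ → v ~ w → w ∈ (L ++ h ∷ []) ++ h′ ∷ L′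
    closed m vw@(lv , _) with ∈-++⁻ (L ++ h ∷ []) m
    closed m vw@(lv , _) | inj₂ (here refl) = contradiction hh′ lv
    closed m vw          | inj₂ (there m′)  = covers (~-trans (in′ (out′ m′)) vw)
    closed m vw@(lv , _) | inj₁ m′ with ∈-++⁻ L m′
    ... | inj₁ m₁          = covers (~-trans (proj₁ (out m₁)) vw)
    ... | inj₂ (here refl) = contradiction hh lv

  saturated-together : ∀ {g₀} → Heavy g₀ → x ≢ y → x ~ y → Saturated x y
  saturated-together {x} {y} hg₀ x≢y xy@(lx , ly , _) =
    first-exit (any? (λ v → ~? x v ×-dec (¬? (v ≟ x) ×-dec ¬? (v ≟ y))))
    where
    second-exit : ∀ {k h} → x ~ k → k ≢ y → (x ≡ k → ∀ v → x ~ v → v ≢ y → v ≡ x) → Adj G k h → Heavy h → Saturated x y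
    -- Deleting `k` and `h` makes the second exit disjoint from the first; the clique member `y`
    -- survives as starting point.
    second-exit {k} {h} xk@(_ , lk , _) k≢y only kh hh with find-exit hg₀ k h xy (k≢y ∘ sym) (light≢heavy ly hh)
    ... | exit {from = k′} xk′ hh′ k′h′ k′≢k _ _ h′≢h with k′ ≟ x
    ...   | no k′≢x  = two-armed x≢y xy xk xk′ (k′≢k ∘ sym) k≢y k′≢x only kh k′h′ hh hh′ (h′≢h ∘ sym)
    -- If the second exit starts at `x`, the roles are exchanged: starting from `y`, the path covers
    -- the rest of the clique, leaves through `k` and returns to `x`.
    ...   | yes refl = Saturated-sym (two-armed (x≢y ∘ sym) (~-sym xy) (~-trans (~-sym xy) xk) (~-sym xy)
                         (k′≢k ∘ sym) (k′≢k ∘ sym) x≢y (λ { refl → contradiction refl k≢y }) kh k′h′ hh hh′ (h′≢h ∘ sym))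
    first-exit : Dec (∃[ v ] (x ~ v × (v ≢ x × v ≢ y))) → Saturated x y
    first-exit (yes (k₀ , xk₀ , k₀≢x , k₀≢y)) with find-exit hg₀ x y xk₀ k₀≢x k₀≢y
    ... | exit xk hh kh k≢x k≢y _ _ = second-exit xk k≢y (λ { refl → contradiction refl k≢x }) kh hh
    -- The clique is {x, y}, so an exit avoiding `y` starts at `x`.
    first-exit (no none) with find-exit hg₀ y y (~-refl lx) x≢y x≢y
    ... | exit xk hh kh k≢y _ _ _ = second-exit xk k≢y
      (λ _ v xv v≢y → decidable-stable (v ≟ x) (λ v≢x → none (v , xv , v≢x , v≢y))) kh hh

  -- Inserting the remaining light cliques.

  record Ends (w y : V G) : Set where
    constructor ends
    field
      {k₁ k₂ h₁ h₂} : V G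
      w~k₁  : w ~ k₁
      w~k₂  : w ~ k₂
      -- The condition under which `span` covers the clique from `k₁` to `k₂`.
      only  : k₁ ≡ k₂ → ∀ v → w ~ v → v ≡ k₁
      hvy₁  : Heavy h₁
      hvy₂  : Heavy h₂
      kh₁   : Adj G k₁ h₁
      kh₂   : Adj G k₂ h₂
      h₁≢h₂ : h₁ ≢ h₂
      -- On a path ending in `y`, this gives the heavy ends successors.
      h₁≢y  : h₁ ≢ y
      h₂≢y  : h₂ ≢ y

  two-ends : ∀ {g₀} → Heavy g₀ → Light w → ¬ w ~ y → Ends w y
  two-ends {w} {y} hg₀ lw ¬wy = from-first (find-exit hg₀ y y (~-refl lw) (≢y (~-refl lw)) (≢y (~-refl lw)))
    where
    ≢y : w ~ v → v ≢ y
    ≢y wv refl = ¬wy wv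
    from-first : Exit w y y → Ends w y
    from-first (exit {k₁} {h₁} wk₁@(_ , lk₁ , _) hh₁ kh₁ _ _ h₁≢y _) =
      from-second (any? (λ v → ~? w v ×-dec ¬? (v ≟ k₁)))
      where
      avoiding-h₁ : Exit w h₁ y
      avoiding-h₁ = find-exit hg₀ h₁ y wk₁ (light≢heavy lk₁ hh₁) (≢y wk₁)
      -- König for two edges: k₁h₁, an edge avoiding k₁ and one avoiding h₁
      -- are not all covered by a single vertex.
      match : (e : Exit w k₁ y) (f : Exit w h₁ y) → Dec (Exit.to e ≡ h₁) → Dec (Exit.from f ≡ k₁) → Ends w y
      match (exit wk₂ hh₂ kh₂ k₂≢k₁ _ _ h₂≢y) _ (no h₂≢h₁) _ =
        ends wk₁ wk₂ (λ eq → contradiction (sym eq) k₂≢k₁) hh₁ hh₂ kh₁ kh₂ (h₂≢h₁ ∘ sym) h₁≢y h₂≢y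
      match _ (exit wk₃ hh₃ kh₃ _ _ h₃≢h₁ h₃≢y) (yes _) (no k₃≢k₁) =
        ends wk₁ wk₃ (λ eq → contradiction (sym eq) k₃≢k₁) hh₁ hh₃ kh₁ kh₃ (h₃≢h₁ ∘ sym) h₁≢y h₃≢y
      match (exit wk₂ hh₂ kh₂ k₂≢k₁ _ _ h₂≢y) (exit _ hh₃ kh₃ _ _ h₃≢h₁ h₃≢y) (yes refl) (yes refl) =
        ends wk₁ wk₂ (λ eq → contradiction (sym eq) k₂≢k₁) hh₃ hh₂ kh₃ kh₂ h₃≢h₁ h₃≢y h₂≢y
      from-second : Dec (∃[ v ] (w ~ v × v ≢ k₁)) → Ends w y
      from-second (yes (k₀ , wk₀ , k₀≢k₁)) =
        let e = find-exit hg₀ k₁ y wk₀ k₀≢k₁ (≢y wk₀) in match e avoiding-h₁ (Exit.to e ≟ h₁) (Exit.from avoiding-h₁ ≟ k₁)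
      -- The clique is just `k₁`: both edges start there, and only their heavy ends have to differ.
      from-second (no alone) with avoiding-h₁
      ... | exit {k₂} wk₂ hh₂ kh₂ _ _ h₂≢h₁ h₂≢y =
        ends wk₁ wk₂ (λ _ v wv → decidable-stable (v ≟ k₁) (λ ne → alone (v , wv , ne)))
          hh₁ hh₂ kh₁ kh₂ (h₂≢h₁ ∘ sym) h₁≢y h₂≢y

  Extends : Saturated x y → Saturated x y → Set
  Extends S T = ∀ {v} → v ∈ Saturated.vertices S → v ∈ Saturated.vertices T

  -- Let b₁ and b₂ follow h₁ and h₂ on the path, h₁ coming first. The new path is x...h₁, the clique
  -- from k₁ to k₂, h₂...b₁ backwards, then b₂...y; the link from b₁ to b₂ exists in `G′` as both
  -- are heavy.
  insert-clique : ∀ {g₀} → Heavy g₀ → (S : Saturated x y) → w ∉ Saturated.vertices S →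
    ∃[ T ] (Extends S T × w ∈ Saturated.vertices T)
  insert-clique {x} {y} {w} hg₀ (saturated {P} p@(_ , t) u hs cl) w∉P with heavy? w
  ... | yes hw = contradiction (hs hw) w∉P
  ... | no lw  = place (two-ends hg₀ lw (~∉P (end∈ t)))
    where
    ~∉P : v ∈ P → ¬ w ~ v
    ~∉P m wv = w∉P (cl m (~-sym wv))
    -- A light successor of `h` shares the neighbour `h` with `k`, so it would lie in the clique of
    -- `w`, which is disjoint from the path.
    next-heavy : ∀ {k h b i} → w ~ k → Adj G k h → Link i h b → b ∈ P → Heavy b
    next-heavy wk kh (missing _ hb _) m = hb
    next-heavy {k} {h} {b} wk@(_ , lk , _) kh (edge hb) m =
      decidable-stable (heavy? b) (λ lb → ~∉P m (~-trans wk (~-common lk lb (adj-sym kh) hb)))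
    splice : ∀ {k₁ k₂ h₁ h₂ b₁ b₂} Q S → w ~ k₁ → w ~ k₂ → (k₁ ≡ k₂ → ∀ v → w ~ v → v ≡ k₁) →
      Adj G k₁ h₁ → Adj G k₂ h₂ → pairs P ≡ Q ++ S → (h₁ , b₁) ∈ Q → (h₂ , b₂) ∈ S →
      ∃[ T ] ((∀ {v} → v ∈ P → v ∈ Saturated.vertices T) × w ∈ Saturated.vertices T)
    splice {k₁} {k₂} Q S wk₁ wk₂ only kh₁ kh₂ eq m₁ m₂
      with split₂ Q S t eq m₁ m₂ | span {C = w ~_} (~? w) (~-linked (λ q → q)) wk₁ wk₂ only
    ... | cut₂ {l₁ = l₁} {l₂} {l₃} t₁ e₁ t₂ e₂ t₃ refl refl | L , q , uL , into , out =
      saturated (path-join (_ , t₁) (0 , edge (adj-sym kh₁)) (path-join q (0 , edge kh₂)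
                  (path-join (path-rev (_ , t₂)) (heavy-linked hb₁ hb₂) (_ , t₃))))
        (Unique-↭ perm (Unique.++⁺ uL u (λ { (m , m′) → ~∉P m′ (out m) }))) (old ∘ hs) closed ,
      old , new (~-refl lw)
      where
      b₁∈ = ∈-++⁺ˡ {ys = l₃} (start∈ t₂)
      b₂∈ = ∈-++⁺ʳ l₂ (start∈ t₃)
      hb₁ = next-heavy wk₁ kh₁ e₁ (∈-++⁺ʳ l₁ b₁∈)
      hb₂ = next-heavy wk₂ kh₂ e₂ (∈-++⁺ʳ l₁ b₂∈)
      perm : L ++ (l₁ ++ (l₂ ++ l₃)) ↭ l₁ ++ (L ++ (reverse l₂ ++ l₃))
      perm = ↭-trans (Perm.shifts L l₁) (Perm.++⁺ˡ l₁ (Perm.++⁺ˡ L (Perm.++⁺ʳ l₃ (↭-sym (↭-reverse l₂)))))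
      old : v ∈ l₁ ++ (l₂ ++ l₃) → v ∈ l₁ ++ (L ++ (reverse l₂ ++ l₃))
      old m = ∈-resp-↭ perm (∈-++⁺ʳ L m)
      new : w ~ v → v ∈ l₁ ++ (L ++ (reverse l₂ ++ l₃))
      new wv = ∈-resp-↭ perm (∈-++⁺ˡ (into wv))
      closed : a ∈ l₁ ++ (L ++ (reverse l₂ ++ l₃)) → a ~ b → b ∈ l₁ ++ (L ++ (reverse l₂ ++ l₃))
      closed m ab with ∈-++⁻ L (∈-resp-↭ (↭-sym perm) m)
      ... | inj₁ m′ = new (~-trans (out m′) ab)
      ... | inj₂ m′ = old (cl m′ ab)
    place : Ends w y → ∃[ T ] ((∀ {v} → v ∈ P → v ∈ Saturated.vertices T) × w ∈ Saturated.vertices T)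
    place (ends wk₁ wk₂ only hh₁ hh₂ kh₁ kh₂ h₁≢h₂ h₁≢y h₂≢y)
      with ∈-pairs-next t (hs hh₁) h₁≢y | ∈-pairs-next t (hs hh₂) h₂≢y
    ... | b₁ , m₁ | b₂ , m₂ with ∈-order m₁ m₂ (h₁≢h₂ ∘ cong proj₁)
    ... | Q , S , eq , inj₁ (q , s) = splice Q S wk₁ wk₂ only kh₁ kh₂ eq q s
    ... | Q , S , eq , inj₂ (q , s) =
      splice Q S wk₂ wk₁ (λ e v wv → trans (only (sym e) v wv) (sym e)) kh₂ kh₁ eq q s

  -- Spanning paths of `G′`, and the theorem.

  saturated⇒spanning : ∀ {g₀} → Heavy g₀ → ∀ ws (S : Saturated x y) →
    ∃[ T ] (Extends S T × (∀ {v} → v ∈ ws → v ∈ Saturated.vertices T))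
  saturated⇒spanning hg₀ []       S = S , (λ m → m) , λ ()
  saturated⇒spanning hg₀ (w ∷ ws) S with saturated⇒spanning hg₀ ws S
  ... | T , S⊆T , all with w ∈? Saturated.vertices T
  ... | yes m = T , S⊆T , λ { (here refl) → m ; (there q) → all q }
  ... | no w∉ with insert-clique hg₀ T w∉
  ... | U , T⊆U , m = U , T⊆U ∘ S⊆T , λ { (here refl) → m ; (there q) → T⊆U (all q) }

  -- A walk can leave a light clique only to a heavy vertex, so by connectivity there is a single
  -- clique.
  all-light⇒~ : (∀ v → Light v) → ∀ u v → u ~ v
  all-light⇒~ light u v = decidable-stable (~? u v) λ ¬uv →
    let a , b , ua , ¬ub , ab , _ = walk-exit {Q = λ _ → ⊤} (~? u) (proj₂ (connected u v)) (All.universal (λ _ → tt) _)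
                                      (~-refl (light u)) ¬uv
    in ¬ub (~-step ua (light b) ab)

  spanning-path : x ≢ y → ∃[ l ] (Path x y l × Unique l × (∀ v → v ∈ l))
  spanning-path {x} {y} x≢y with any? heavy?
  ... | no all-light with span {C = x ~_} (~? x) (~-linked (λ q → q)) (~-refl (λ hx → all-light (x , hx)))
                             (all-light⇒~ (λ v hv → all-light (v , hv)) x y) (λ eq → contradiction eq x≢y)
  ...   | L , p , u , into , _ = L , p , u , λ v → into (all-light⇒~ (λ v hv → all-light (v , hv)) x v)
  spanning-path {x} {y} x≢y | yes (g₀ , hg₀) with saturated⇒spanning hg₀ (allFin _) base
    where
    base : Saturated x y
    base with ~? x y
    ... | yes xy = saturated-together hg₀ x≢y xy
    ... | no ¬xy = saturated-apart hg₀ x≢y ¬xy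
  ... | saturated p u _ _ , _ , all = _ , p , u , λ v → all (∈-allFin v)

theorem1p5 : (G : Graph) → KConnected 3 G → (α : ℕ) → IsBipIndepNum G α →
    (∀ x y → x ≢ y → ¬ Adj G x y → Dist G x y 2 → deg G x ⊔ deg G y ≥ suc α) →
    HamiltonianConnected G
theorem1p5 G conn α ((suc s , t , _ , t≥1 , s+t , bip) , _) fan x y x≢y
  with Light.spanning-path G conn α fan x≢y
... | l , (_ , tr) , u , cov =
  Closure.HamPath-closure G α s t t≥1 (suc-injective s+t) bip x≢y tr u cov
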